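{- Let $p=p(n)\in[0,1/2]$ satisfy $n\,p(n)\to\infty$ as $n\to\infty$ (i.e., $p\in\omega(1/n)$). For every $n$, let $T$ be a random tournament on $n$ alternatives generated according to the Condorcet random model with parameter $p$. Then with high probability (i.e., with probability tending to $1$ as $n\to\infty$), every alternative in $T$ is a $5$-king.
   Context: A tournament on a finite set $V$ of alternatives is a complete orientation: for every two distinct $x,y\in V$ exactly one of $x\succ y$ ("$x$ dominates $y$") or $y\succ x$ holds. For an integer $k\ge 2$, an alternative $x$ is a $k$-king if for every other alternative $y$ there is a directed path from $x$ to $y$ of length (number of edges) at most $k$. Condorcet random model with parameter $0\le p\le 1/2$: alternatives are $x_1,\dots,x_n$; independently for each pair $i<j$, $x_j\succ x_i$ with probability $p$ and $x_i\succ x_j$ with probability $1-p$.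
   Formalization: The parameter p(n) of the Condorcet random model is taken to be rational for every n, rather than an arbitrary real number in [0,1/2]. -}

module Defs where

open import Data.Bool using (Bool; true; false; not; if_then_else_)
open import Data.Nat using (ℕ; zero; suc)
import Data.Nat as ℕ
open import Data.Fin using (Fin; zero; suc)
open import Data.Vec using (Vec; []; _∷_; lookup)
open import Data.List using (List; []; _∷_; map; concatMap; foldr)
open import Data.Product using (_×_; _,_; ∃-syntax)
open import Data.Unit using (⊤; tt)
open import Data.Rational using (ℚ; _+_; _*_; _-_; 0ℚ; 1ℚ)
open import Relation.Binary.PropositionalEquality using (_≡_; _≢_)
open import Relation.Nullary using (Dec; does)
open import Relation.Unary using (Pred; Decidable)
import Level

-- A tournament on n alternatives in the Condorcet model, built vertex by vertex.
-- Tournament (suc n) = (tournament on the n older alternatives) × (a vector v of n bits).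
-- In Fin (suc n), 'zero' is the newly added alternative, which has the LARGEST
-- label among the n+1 alternatives; 'suc i' is the older alternative i.
-- v[i] = true means the new alternative (larger label) beats older i: an "upset",
-- which has probability p; v[i] = false (older/smaller label wins) has prob. 1 - p.
Tournament : ℕ → Set
Tournament zero    = ⊤
Tournament (suc n) = Tournament n × Vec Bool n

dom : ∀ {n} → Tournament n → Fin n → Fin n → Bool
dom {suc n} (t , v) zero    zero    = false
dom {suc n} (t , v) zero    (suc j) = lookup v j
dom {suc n} (t , v) (suc i) zero    = not (lookup v i)
dom {suc n} (t , v) (suc i) (suc j) = dom t i j

_≻_ : ∀ {n} → Tournament n → Fin n → Fin n → Set
_≻_ T x y = dom T x y ≡ true

data Walk {n : ℕ} (T : Tournament n) : ℕ → Fin n → Fin n → Set where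
  nil  : ∀ {x} → Walk T 0 x x
  step : ∀ {m x z y} → _≻_ T x z → Walk T m z y → Walk T (suc m) x y

IsKing : ℕ → ∀ {n} → Tournament n → Fin n → Set
IsKing k {n} T x = ∀ (y : Fin n) → y ≢ x → ∃[ m ] (m ℕ.≤ k × Walk T m x y)

AllKings : ℕ → ∀ {n} → Tournament n → Set
AllKings k {n} T = ∀ (x : Fin n) → IsKing k T x

allVec : ∀ n → List (Vec Bool n)
allVec zero    = [] ∷ []
allVec (suc n) = concatMap (λ v → (true ∷ v) ∷ (false ∷ v) ∷ []) (allVec n)

allT : ∀ n → List (Tournament n)
allT zero    = tt ∷ []
allT (suc n) = concatMap (λ t → map (λ v → (t , v)) (allVec n)) (allT n)

edgeWeight : ℚ → Bool → ℚ
edgeWeight p b = if b then p else (1ℚ - p)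

vecWeight : ∀ {m} → ℚ → Vec Bool m → ℚ
vecWeight p []       = 1ℚ
vecWeight p (b ∷ v)  = edgeWeight p b * vecWeight p v

weight : ∀ {n} → ℚ → Tournament n → ℚ
weight {zero}  p tt      = 1ℚ
weight {suc n} p (t , v) = weight p t * vecWeight p v

Prob : ∀ n → ℚ → (P : Pred (Tournament n) Level.zero) → Decidable P → ℚ
Prob n p P dec = foldr (λ t acc → (if does (dec t) then weight p t else 0ℚ) + acc) 0ℚ (allT n)

{-# OPTIONS --safe #-}
-- Order the alternatives from the weakest (position 0) to the strongest, and put s = 8q, q = ⌊n/32⌋. Let A be
-- the s weakest and B the s strongest alternatives, W the s next weakest and U the s next strongest ones. Paths are
-- sought in the form x → a → u → w → b → y with a ∈ A, u ∈ U, w ∈ W, b ∈ B, where a → u and w → b are upsets, the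
-- other three edges follow the order, and possibly x = a or b = y.
-- An alternative misses q given upsets with probability δ = (1-p)^q ≤ 1/(1+qp) → 0. The k-th weakest x has itself and
-- k weaker candidates a, each independently useless with probability at most 1/2 + δ/2 ≤ 3/4, so it fails with
-- probability at most δ(3/4)^k. The series Σ (k+2) δ(3/4)^k ≤ 20δ pays for a union bound over pairs (x, b) in which b is
-- at most as far from the strong end as x from the weak end; the other pairs are covered by reversing
-- the order and all edges. Alternatives x outside A fail with probability (3/4)^s, which beats polynomial factors.

module Submission where

open import Defs
open import Algebra.Bundles using (CommutativeRing)
open import Data.Bool using (Bool; true; false; not; _∧_; _∨_; if_then_else_)
import Data.Bool as Bool
open import Data.Fin using (Fin; zero; suc; toℕ; fromℕ<)
open import Data.Fin.Properties using (toℕ<n; toℕ-fromℕ<; toℕ-injective)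
open import Data.Integer using (+_)
import Data.Integer as ℤ
import Data.Integer.Properties as ℤ
open import Data.List using (List; []; _∷_; _++_; map; concatMap; foldr; filter; length; upTo; findᵇ)
open import Data.List.Membership.Propositional using (_∈_; _∉_)
open import Data.List.Membership.Propositional.Properties
  using (∈-++⁺ˡ; ∈-++⁺ʳ; ∈-++⁻; ∈-map⁺; ∈-map⁻; ∈-filter⁺; ∈-filter⁻; ∈-upTo⁺; ∈-upTo⁻)
open import Data.List.Properties using (length-map; length-upTo; filter-all; filter-≐; filter-accept; filter-reject)
open import Data.List.Relation.Unary.All as All using (All; []; _∷_)
open import Data.List.Relation.Unary.Any using (here; there)
open import Data.List.Relation.Unary.Unique.Propositional using (Unique; []; _∷_)
open import Data.List.Relation.Unary.Unique.Propositional.Properties using (map⁺; filter⁺; upTo⁺)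
open import Data.Maybe using (just; nothing; maybe′)
open import Data.Nat using (ℕ; zero; suc)
import Data.Nat as ℕ
open import Data.Nat.DivMod using (m≡m%n+[m/n]*n; m%n<n; m*n/n≡m; /-monoˡ-≤; m/n*n≤m)
import Data.Nat.Properties as ℕ
import Data.Nat.Tactic.RingSolver as ℕ-Solver
open import Data.Product using (_×_; _,_; proj₁; proj₂; ∃-syntax)
open import Data.Product.Properties using (≡-dec)
open import Data.Rational
  using (ℚ; mkℚ; _+_; _*_; _-_; -_; _≤_; _<_; _/_; 0ℚ; 1ℚ; ½; *≤*; *<*; toℚᵘ; nonNegative)
open import Data.Rational.Properties hiding (_≟_)
import Data.Rational.Properties as ℚ
import Data.Rational.Unnormalised as ℚᵘ
import Data.Rational.Unnormalised.Properties as ℚᵘ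
open import Data.Sum using (_⊎_; inj₁; inj₂)
open import Data.Unit using (tt)
open import Data.Vec using (Vec; []; _∷_; lookup)
open import Function using (_∘_)
import Level
open import Relation.Binary.Definitions using (DecidableEquality)
open import Relation.Binary.PropositionalEquality
open import Relation.Nullary using (does; yes; no; contradiction; ¬?)
open import Relation.Nullary.Decidable using (dec⇒maybe; dec-true; dec-false)
open import Relation.Unary using (Decidable; Pred)
open import Tactic.RingSolver using (solve-∀)
open import Tactic.RingSolver.Core.AlmostCommutativeRing using (AlmostCommutativeRing; fromCommutativeRing)
open import Algebra.Properties.Semiring.Exp (CommutativeRing.semiring +-*-commutativeRing)
  using (_^_; ^-assocʳ)
open import Algebra.Properties.CommutativeSemiring.Exp (CommutativeRing.commutativeSemiring +-*-commutativeRing)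
  using (^-distrib-*)

-- Rational estimates

ℚ-ring : AlmostCommutativeRing _ _
ℚ-ring = fromCommutativeRing +-*-commutativeRing (λ x → dec⇒maybe (0ℚ ℚ.≟ x))

*-monoˡ : ∀ {r x y} → 0ℚ ≤ r → x ≤ y → r * x ≤ r * y
*-monoˡ {r} 0≤r = *-monoˡ-≤-nonNeg r {{nonNegative 0≤r}}

*-monoʳ : ∀ {r x y} → 0ℚ ≤ r → x ≤ y → x * r ≤ y * r
*-monoʳ {r} 0≤r = *-monoʳ-≤-nonNeg r {{nonNegative 0≤r}}

*-mono : ∀ {x y u v} → 0ℚ ≤ y → 0ℚ ≤ u → x ≤ y → u ≤ v → x * u ≤ y * v
*-mono 0≤y 0≤u x≤y u≤v = ≤-trans (*-monoʳ 0≤u x≤y) (*-monoˡ 0≤y u≤v)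

0≤+ : ∀ {x y} → 0ℚ ≤ x → 0ℚ ≤ y → 0ℚ ≤ x + y
0≤+ = +-mono-≤

0≤* : ∀ {x y} → 0ℚ ≤ x → 0ℚ ≤ y → 0ℚ ≤ x * y
0≤* {x} 0≤x 0≤y = ≤-trans (≤-reflexive (sym (*-zeroʳ x))) (*-monoˡ 0≤x 0≤y)

0≤- : ∀ {x y} → x ≤ y → 0ℚ ≤ y - x
0≤- {x} x≤y = ≤-trans (≤-reflexive (sym (+-inverseʳ x))) (+-monoˡ-≤ (- x) x≤y)

≤-byDiff : ∀ {x y d} → y ≡ x + d → 0ℚ ≤ d → x ≤ y
≤-byDiff {x} {y} {d} eq 0≤d = ≤-trans (≤-reflexive (sym (+-identityʳ x))) (≤-trans (+-monoʳ-≤ x 0≤d) (≤-reflexive (sym eq)))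

0≤1 : 0ℚ ≤ 1ℚ
0≤1 = ≤ᵇ⇒≤ _

ι : ℕ → ℚ
ι n = + n / 1

-- `_/_` normalises by a gcd, which does not compute on a variable, so the equation is checked on
-- unnormalised representatives.
ι-suc : ∀ n → ι (suc n) ≡ 1ℚ + ι n
ι-suc n = toℚᵘ-injective (begin
  toℚᵘ (ι (suc n))               ≈⟨ toℚᵘ-fromℚᵘ (ℚᵘ.mkℚᵘ (+ suc n) 0) ⟩
  ℚᵘ.mkℚᵘ (+ suc n) 0            ≈⟨ ℚᵘ.*≡* (cong (ℤ._* + 1) (cong (ℤ._+_ (+ 1)) (sym (ℤ.*-identityʳ (+ n))))) ⟩
  ℚᵘ.1ℚᵘ ℚᵘ.+ ℚᵘ.mkℚᵘ (+ n) 0    ≈⟨ ℚᵘ.+-congʳ ℚᵘ.1ℚᵘ (toℚᵘ-fromℚᵘ (ℚᵘ.mkℚᵘ (+ n) 0)) ⟨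
  ℚᵘ.1ℚᵘ ℚᵘ.+ toℚᵘ (ι n)         ≈⟨ toℚᵘ-homo-+ 1ℚ (ι n) ⟨
  toℚᵘ (1ℚ + ι n)                ∎)
  where open import Relation.Binary.Reasoning.Setoid ℚᵘ.≃-setoid

0≤ι : ∀ n → 0ℚ ≤ ι n
0≤ι zero    = ≤-refl
0≤ι (suc n) = ≤-trans (0≤+ 0≤1 (0≤ι n)) (≤-reflexive (sym (ι-suc n)))

ι-mono : ∀ {m n} → m ℕ.≤ n → ι m ≤ ι n
ι-mono {n = n} ℕ.z≤n = 0≤ι n
ι-mono (ℕ.s≤s {m} {n} m≤n) = begin
  ι (suc m) ≡⟨ ι-suc m ⟩
  1ℚ + ι m  ≤⟨ +-monoʳ-≤ 1ℚ (ι-mono m≤n) ⟩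
  1ℚ + ι n  ≡⟨ ι-suc n ⟨
  ι (suc n) ∎
  where open ≤-Reasoning

ι-+ : ∀ m n → ι (m ℕ.+ n) ≡ ι m + ι n
ι-+ zero    n = sym (+-identityˡ (ι n))
ι-+ (suc m) n = begin
  ι (suc (m ℕ.+ n))  ≡⟨ ι-suc (m ℕ.+ n) ⟩
  1ℚ + ι (m ℕ.+ n)   ≡⟨ cong (_+_ 1ℚ) (ι-+ m n) ⟩
  1ℚ + (ι m + ι n)   ≡⟨ +-assoc 1ℚ (ι m) (ι n) ⟨
  1ℚ + ι m + ι n     ≡⟨ cong (_+ ι n) (ι-suc m) ⟨
  ι (suc m) + ι n    ∎
  where open ≡-Reasoning

ι-* : ∀ m n → ι (m ℕ.* n) ≡ ι m * ι n
ι-* zero    n = sym (*-zeroˡ (ι n))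
ι-* (suc m) n = begin
  ι (n ℕ.+ m ℕ.* n)   ≡⟨ ι-+ n (m ℕ.* n) ⟩
  ι n + ι (m ℕ.* n)   ≡⟨ cong (_+_ (ι n)) (ι-* m n) ⟩
  ι n + ι m * ι n     ≡⟨ lemma (ι m) (ι n) ⟩
  (1ℚ + ι m) * ι n    ≡⟨ cong (_* ι n) (ι-suc m) ⟨
  ι (suc m) * ι n     ∎
  where
  open ≡-Reasoning
  lemma : ∀ a b → b + a * b ≡ (1ℚ + a) * b
  lemma = solve-∀ ℚ-ring

-- The denominator of `ε` serves as `K`: the product is then the numerator, a positive integer.
archimedean : ∀ ε → 0ℚ < ε → ∃[ K ] 1ℚ ≤ ι K * ε
archimedean (mkℚ (+ zero) d c) (*<* (ℤ.+<+ ()))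
archimedean ε@(mkℚ (+ suc a) d c) _ = suc d , toℚᵘ-cancel-≤ (ℚᵘ.≤-respʳ-≃ (ℚᵘ.≃-sym eq) (ℚᵘ.*≤* (ℤ.+≤+ (begin
    1 ℕ.* (1 ℕ.* suc d)      ≡⟨ ℕ.*-identityˡ _ ⟩
    1 ℕ.* suc d              ≤⟨ ℕ.*-monoˡ-≤ (suc d) (ℕ.s≤s (ℕ.z≤n {a})) ⟩
    suc a ℕ.* suc d          ≡⟨ ℕ.*-comm (suc a) (suc d) ⟩
    suc d ℕ.* suc a          ≡⟨ ℕ.*-identityʳ _ ⟨
    (suc d ℕ.* suc a) ℕ.* 1  ∎))))
  where
  open ℕ.≤-Reasoning
  eq : toℚᵘ (ι (suc d) * ε) ℚᵘ.≃ ℚᵘ.mkℚᵘ (+ suc d) 0 ℚᵘ.* toℚᵘ ε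
  eq = ℚᵘ.≃-trans (toℚᵘ-homo-* (ι (suc d)) ε) (ℚᵘ.*-congʳ (toℚᵘ-fromℚᵘ (ℚᵘ.mkℚᵘ (+ suc d) 0)))

^-nonNeg : ∀ {x} n → 0ℚ ≤ x → 0ℚ ≤ x ^ n
^-nonNeg zero    0≤x = 0≤1
^-nonNeg (suc n) 0≤x = 0≤* 0≤x (^-nonNeg n 0≤x)

^-monoˡ-≤ : ∀ {x y} n → 0ℚ ≤ x → x ≤ y → x ^ n ≤ y ^ n
^-monoˡ-≤ zero    0≤x x≤y = ≤-refl
^-monoˡ-≤ (suc n) 0≤x x≤y = *-mono (≤-trans 0≤x x≤y) (^-nonNeg n 0≤x) x≤y (^-monoˡ-≤ n 0≤x x≤y)

^-≤1 : ∀ {x} n → 0ℚ ≤ x → x ≤ 1ℚ → x ^ n ≤ 1ℚ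
^-≤1 zero    0≤x x≤1 = ≤-refl
^-≤1 (suc n) 0≤x x≤1 = *-mono 0≤1 (^-nonNeg n 0≤x) x≤1 (^-≤1 n 0≤x x≤1)

^-antimonoʳ-≤ : ∀ {x m n} → 0ℚ ≤ x → x ≤ 1ℚ → m ℕ.≤ n → x ^ n ≤ x ^ m
^-antimonoʳ-≤ {n = n} 0≤x x≤1 ℕ.z≤n       = ^-≤1 n 0≤x x≤1
^-antimonoʳ-≤         0≤x x≤1 (ℕ.s≤s m≤n) = *-monoˡ 0≤x (^-antimonoʳ-≤ 0≤x x≤1 m≤n)

-- The bound 1/(1+np) on (1-p)^n in division-free form. In the induction step, (1-p)(1+(n+1)p) falls
-- short of 1+np by exactly (n+1)p².
bernoulli : ∀ {p} n → 0ℚ ≤ p → p ≤ 1ℚ → (1ℚ - p) ^ n * (1ℚ + ι n * p) ≤ 1ℚ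
bernoulli {p} zero    0≤p p≤1 = ≤-reflexive (trans (*-identityˡ _) (trans (cong (_+_ 1ℚ) (*-zeroˡ p)) (+-identityʳ 1ℚ)))
bernoulli {p} (suc n) 0≤p p≤1 = begin
  (1ℚ - p) * c * (1ℚ + ι (suc n) * p)      ≡⟨ cong (λ k → (1ℚ - p) * c * (1ℚ + k * p)) (ι-suc n) ⟩
  (1ℚ - p) * c * (1ℚ + (1ℚ + ι n) * p)     ≤⟨ ≤-byDiff (lemma p c (ι n)) (0≤* (^-nonNeg n (0≤- p≤1)) (0≤* (0≤+ 0≤1 (0≤ι n)) (0≤* 0≤p 0≤p))) ⟩
  c * (1ℚ + ι n * p)                       ≤⟨ bernoulli n 0≤p p≤1 ⟩
  1ℚ                                       ∎
  where
  open ≤-Reasoning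
  c = (1ℚ - p) ^ n
  lemma : ∀ p c k → c * (1ℚ + k * p) ≡ (1ℚ - p) * c * (1ℚ + (1ℚ + k) * p) + c * ((1ℚ + k) * (p * p))
  lemma = solve-∀ ℚ-ring

-- This is n+1 ≤ 2^n: since n+2 ≤ 2(n+1), the first factor at most doubles while the second is
-- halved.
suc*½^≤1 : ∀ n → ι (suc n) * ½ ^ n ≤ 1ℚ
suc*½^≤1 zero    = ≤-refl
suc*½^≤1 (suc n) = begin
  ι (suc (suc n)) * (½ * ½ ^ n)   ≡⟨ cong (_* (½ * ½ ^ n)) (ι-suc (suc n)) ⟩
  (1ℚ + ι (suc n)) * (½ * ½ ^ n)  ≤⟨ *-monoʳ (0≤* (≤ᵇ⇒≤ {0ℚ} {½} _) 0≤h) (+-monoˡ-≤ (ι (suc n)) (ι-mono (ℕ.s≤s (ℕ.z≤n {n})))) ⟩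
  (ι (suc n) + ι (suc n)) * (½ * ½ ^ n) ≡⟨ lemma (ι (suc n)) (½ ^ n) ⟩
  ι (suc n) * ½ ^ n               ≤⟨ suc*½^≤1 n ⟩
  1ℚ                              ∎
  where
  open ≤-Reasoning
  0≤h = ^-nonNeg n (≤ᵇ⇒≤ {0ℚ} {½} _)
  lemma : ∀ a b → (a + a) * (½ * b) ≡ a * b
  lemma = solve-∀ ℚ-ring

sumBelow : ℕ → (ℕ → ℚ) → ℚ
sumBelow zero    c = 0ℚ
sumBelow (suc n) c = c n + sumBelow n c

sumBelow-mono : ∀ n {c d} → (∀ k → c k ≤ d k) → sumBelow n c ≤ sumBelow n d
sumBelow-mono zero    c≤d = ≤-refl
sumBelow-mono (suc n) c≤d = +-mono-≤ (c≤d n) (sumBelow-mono n c≤d)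

sumBelow-const : ∀ n c → sumBelow n (λ _ → c) ≡ ι n * c
sumBelow-const zero    c = sym (*-zeroˡ c)
sumBelow-const (suc n) c = begin
  c + sumBelow n (λ _ → c)  ≡⟨ cong (_+_ c) (sumBelow-const n c) ⟩
  c + ι n * c               ≡⟨ lemma c (ι n) ⟩
  (1ℚ + ι n) * c            ≡⟨ cong (_* c) (ι-suc n) ⟨
  ι (suc n) * c             ∎
  where
  open ≡-Reasoning
  lemma : ∀ c k → c + k * c ≡ (1ℚ + k) * c
  lemma = solve-∀ ℚ-ring

sumBelow-+ : ∀ n c d → sumBelow n (λ k → c k + d k) ≡ sumBelow n c + sumBelow n d
sumBelow-+ zero    c d = refl
sumBelow-+ (suc n) c d = trans (cong (_+_ (c n + d n)) (sumBelow-+ n c d)) (lemma (c n) (d n) (sumBelow n c) (sumBelow n d))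
  where
  lemma : ∀ a b x y → a + b + (x + y) ≡ a + x + (b + y)
  lemma = solve-∀ ℚ-ring

ρ : ℚ
ρ = + 3 / 4

0≤ρ : 0ℚ ≤ ρ
0≤ρ = ≤ᵇ⇒≤ _

-- The second summand is the tail of the infinite series from index `n` on, so the left side
-- telescopes and keeps its value at `n = 0`.
arithGeom-≡ : ∀ δ n → sumBelow n (λ k → ι (2 ℕ.+ k) * (δ * ρ ^ k)) + δ * ((ι 4 * ι n + ι 20) * ρ ^ n) ≡ ι 20 * δ
arithGeom-≡ δ zero    = lemma δ
  where
  lemma : ∀ δ → 0ℚ + δ * ((ι 4 * 0ℚ + ι 20) * 1ℚ) ≡ ι 20 * δ
  lemma = solve-∀ ℚ-ring
arithGeom-≡ δ (suc n) = begin
  ι (2 ℕ.+ n) * (δ * r) + S + δ * ((ι 4 * ι (suc n) + ι 20) * (ρ * r))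
    ≡⟨ cong₂ (λ a b → a * (δ * r) + S + δ * ((ι 4 * b + ι 20) * (ρ * r))) (trans (ι-suc (suc n)) (cong (_+_ 1ℚ) (ι-suc n))) (ι-suc n) ⟩
  (1ℚ + (1ℚ + ι n)) * (δ * r) + S + δ * ((ι 4 * (1ℚ + ι n) + ι 20) * (ρ * r))
    ≡⟨ lemma (ι n) δ r S ⟩
  S + δ * ((ι 4 * ι n + ι 20) * r)
    ≡⟨ arithGeom-≡ δ n ⟩
  ι 20 * δ ∎
  where
  open ≡-Reasoning
  r = ρ ^ n
  S = sumBelow n (λ k → ι (2 ℕ.+ k) * (δ * ρ ^ k))
  lemma : ∀ k δ r S → (1ℚ + (1ℚ + k)) * (δ * r) + S + δ * ((ι 4 * (1ℚ + k) + ι 20) * (ρ * r)) ≡ S + δ * ((ι 4 * k + ι 20) * r)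
  lemma = solve-∀ ℚ-ring

arithGeom-≤ : ∀ {δ} n → 0ℚ ≤ δ → sumBelow n (λ k → ι (2 ℕ.+ k) * (δ * ρ ^ k)) ≤ ι 20 * δ
arithGeom-≤ {δ} n 0≤δ = ≤-byDiff (sym (arithGeom-≡ δ n))
  (0≤* 0≤δ (0≤* (0≤+ (0≤* (0≤ι 4) (0≤ι n)) (0≤ι 20)) (^-nonNeg n 0≤ρ)))

-- This is 8^(-n), written as a cube so that each factor can absorb one polynomial factor n+1.
θ : ℕ → ℚ
θ n = ½ ^ n * ½ ^ n * ½ ^ n

0≤θ : ∀ n → 0ℚ ≤ θ n
0≤θ n = 0≤* (0≤* 0≤h 0≤h) 0≤h
  where 0≤h = ^-nonNeg n (≤ᵇ⇒≤ {0ℚ} {½} _)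

θ-def : ∀ n → (½ * ½ * ½) ^ n ≡ θ n
θ-def n = trans (^-distrib-* (½ * ½) ½ n) (cong (_* ½ ^ n) (^-distrib-* ½ ½ n))

-- The comparison is (3/4)^8 ≤ 1/8. It would fail with exponent 7, hence blocks of size 8q.
ρ^8n≤θ : ∀ n → ρ ^ (8 ℕ.* n) ≤ θ n
ρ^8n≤θ n = begin
  ρ ^ (8 ℕ.* n)     ≡⟨ ^-assocʳ ρ 8 n ⟨
  (ρ ^ 8) ^ n       ≤⟨ ^-monoˡ-≤ n (≤ᵇ⇒≤ _) (≤ᵇ⇒≤ _) ⟩
  (½ * ½ * ½) ^ n   ≡⟨ θ-def n ⟩
  θ n               ∎
  where open ≤-Reasoning

-- The comparison is 4(5/8)^8 ≤ 1/8. The left side is the tail bound of `Pr-few` with threshold `n`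
-- among 8n alternatives.
4^n*⅝^8n≤θ : ∀ n → ι 4 ^ n * (+ 5 / 8) ^ (8 ℕ.* n) ≤ θ n
4^n*⅝^8n≤θ n = begin
  ι 4 ^ n * ((+ 5 / 8) ^ (8 ℕ.* n))    ≡⟨ cong (ι 4 ^ n *_) (^-assocʳ (+ 5 / 8) 8 n) ⟨
  ι 4 ^ n * ((+ 5 / 8) ^ 8) ^ n      ≡⟨ ^-distrib-* (ι 4) ((+ 5 / 8) ^ 8) n ⟨
  (ι 4 * (+ 5 / 8) ^ 8) ^ n          ≤⟨ ^-monoˡ-≤ n (≤ᵇ⇒≤ _) (≤ᵇ⇒≤ _) ⟩
  (½ * ½ * ½) ^ n                    ≡⟨ θ-def n ⟩
  θ n                                ∎
  where open ≤-Reasoning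

-- Each half-power takes one linear factor. The union bounds use up two of them, and the third makes
-- the remaining error tend to 0.
suc³*θ≤1 : ∀ n → ι (suc n) * (ι (suc n) * (ι (suc n) * θ n)) ≤ 1ℚ
suc³*θ≤1 n = begin
  a * (a * (a * (t * t * t)))      ≡⟨ lemma a t ⟩
  (a * t) * ((a * t) * (a * t))    ≤⟨ *-mono 0≤1 (0≤* 0≤at 0≤at) (suc*½^≤1 n) (*-mono 0≤1 0≤at (suc*½^≤1 n) (suc*½^≤1 n)) ⟩
  1ℚ                               ∎
  where
  open ≤-Reasoning
  a = ι (suc n)
  t = ½ ^ n
  0≤at : 0ℚ ≤ a * t
  0≤at = 0≤* (0≤ι (suc n)) (^-nonNeg n (≤ᵇ⇒≤ {0ℚ} {½} _))
  lemma : ∀ a t → a * (a * (a * (t * t * t))) ≡ (a * t) * ((a * t) * (a * t))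
  lemma = solve-∀ ℚ-ring

-- Expectation over independent p-biased bits

Edge : Set
Edge = ℕ × ℕ

_≟ₑ_ : DecidableEquality Edge
_≟ₑ_ = ≡-dec ℕ._≟_ ℕ._≟_

Ω : Set
Ω = Edge → Bool

infixl 7 _[_≔_]
_[_≔_] : Ω → Edge → Bool → Ω
(ω [ e ≔ b ]) e′ = if does (e ≟ₑ e′) then b else ω e′

update-same : ∀ ω e b → (ω [ e ≔ b ]) e ≡ b
update-same ω e b rewrite dec-true (e ≟ₑ e) refl = refl

update-other : ∀ ω {e e′} b → e ≢ e′ → (ω [ e ≔ b ]) e′ ≡ ω e′
update-other ω {e} {e′} b e≢e′ rewrite dec-false (e ≟ₑ e′) e≢e′ = refl

update-cong : ∀ {ω ω′} e b → ω ≗ ω′ → ω [ e ≔ b ] ≗ ω′ [ e ≔ b ]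
update-cong e b eq e′ = cong (if_then_else_ (does (e ≟ₑ e′)) b) (eq e′)

update-twice : ∀ ω e b b′ → ω [ e ≔ b ] [ e ≔ b′ ] ≗ ω [ e ≔ b′ ]
update-twice ω e b b′ e′ with does (e ≟ₑ e′)
... | true  = refl
... | false = refl

update-comm : ∀ ω {e₁ e₂} b₁ b₂ → e₁ ≢ e₂ → ω [ e₁ ≔ b₁ ] [ e₂ ≔ b₂ ] ≗ ω [ e₂ ≔ b₂ ] [ e₁ ≔ b₁ ]
update-comm ω {e₁} {e₂} b₁ b₂ e₁≢e₂ e with e₁ ≟ₑ e | e₂ ≟ₑ e
... | yes refl | yes refl = contradiction refl e₁≢e₂
... | yes _    | no _     = refl
... | no _     | yes _    = refl
... | no _     | no _     = refl

Agree : List Edge → Ω → Ω → Set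
Agree es ω ω′ = ∀ e → e ∉ es → ω e ≡ ω′ e

-- Updates made in different orders give assignments that are equal only pointwise, so integrands
-- have to respect pointwise equality.
Ext : (Ω → ℚ) → Set
Ext f = ∀ {ω ω′} → ω ≗ ω′ → f ω ≡ f ω′

ind : Bool → ℚ
ind b = if b then 1ℚ else 0ℚ

0≤ind : ∀ b → 0ℚ ≤ ind b
0≤ind true  = 0≤1
0≤ind false = ≤-refl

ind-≤1 : ∀ b → ind b ≤ 1ℚ
ind-≤1 true  = ≤-refl
ind-≤1 false = 0≤1

ind-∧ : ∀ a b → ind (a ∧ b) ≡ ind a * ind b
ind-∧ true  b = sym (*-identityˡ (ind b))
ind-∧ false b = sym (*-zeroˡ (ind b))

ind-∨ : ∀ a b → ind (a ∨ b) ≤ ind a + ind b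
ind-∨ true  true  = ≤ᵇ⇒≤ _
ind-∨ true  false = ≤-refl
ind-∨ false b     = ≤-reflexive (sym (+-identityˡ (ind b)))

anyBelow : ℕ → (ℕ → Bool) → Bool
anyBelow zero    f = false
anyBelow (suc n) f = f n ∨ anyBelow n f

anyBelow-cong : ∀ n {f g} → f ≗ g → anyBelow n f ≡ anyBelow n g
anyBelow-cong zero    f≗g = refl
anyBelow-cong (suc n) f≗g = cong₂ _∨_ (f≗g n) (anyBelow-cong n f≗g)

anyBelow-false : ∀ n {f} → anyBelow n f ≡ false → ∀ {k} → k ℕ.< n → f k ≡ false
anyBelow-false (suc n) {f} eq {k} k<1+n with f n in fn | k ℕ.≟ n
anyBelow-false (suc n) () k<1+n | true  | _
... | false | yes refl = fn
... | false | no k≢n   = anyBelow-false n eq (ℕ.≤∧≢⇒< (ℕ.s≤s⁻¹ k<1+n) k≢n)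

module Expectation (p : ℚ) (0≤p : 0ℚ ≤ p) (p≤1 : p ≤ 1ℚ) where

  p̄ : ℚ
  p̄ = 1ℚ - p

  0≤p̄ : 0ℚ ≤ p̄
  0≤p̄ = 0≤- p≤1

  mix : ℚ → ℚ → ℚ
  mix x y = p * x + p̄ * y

  mix-mono : ∀ {x x′ y y′} → x ≤ x′ → y ≤ y′ → mix x y ≤ mix x′ y′
  mix-mono x≤x′ y≤y′ = +-mono-≤ (*-monoˡ 0≤p x≤x′) (*-monoˡ 0≤p̄ y≤y′)

  mix-const : ∀ x → mix x x ≡ x
  mix-const x = lemma p x
    where
    lemma : ∀ p x → p * x + (1ℚ - p) * x ≡ x
    lemma = solve-∀ ℚ-ring

  mix-+ : ∀ x y x′ y′ → mix (x + x′) (y + y′) ≡ mix x y + mix x′ y′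
  mix-+ = lemma p p̄
    where
    lemma : ∀ p p̄ x y x′ y′ → p * (x + x′) + p̄ * (y + y′) ≡ p * x + p̄ * y + (p * x′ + p̄ * y′)
    lemma = solve-∀ ℚ-ring

  mix-* : ∀ c x y → mix (c * x) (c * y) ≡ c * mix x y
  mix-* = lemma p p̄
    where
    lemma : ∀ p p̄ c x y → p * (c * x) + p̄ * (c * y) ≡ c * (p * x + p̄ * y)
    lemma = solve-∀ ℚ-ring

  mix-swap : ∀ a b c d → mix (mix a b) (mix c d) ≡ mix (mix a c) (mix b d)
  mix-swap = lemma p p̄
    where
    lemma : ∀ p p̄ a b c d → p * (p * a + p̄ * b) + p̄ * (p * c + p̄ * d) ≡ p * (p * a + p̄ * c) + p̄ * (p * b + p̄ * d)
    lemma = solve-∀ ℚ-ring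

  -- The bits in the list are redrawn independently and all others keep their values in `ω`. As a
  -- function of `ω` this is the conditional expectation given the bits outside the list. When an
  -- edge is listed twice, the later draw overwrites the earlier one.
  E : List Edge → (Ω → ℚ) → Ω → ℚ
  E []       f ω = f ω
  E (e ∷ es) f ω = mix (E es f (ω [ e ≔ true ])) (E es f (ω [ e ≔ false ]))

  Pr : List Edge → (Ω → Bool) → Ω → ℚ
  Pr es A = E es (λ ω → ind (A ω))

  private
    agree-tail : ∀ {e es ω ω′} b → Agree es (ω [ e ≔ b ]) ω′ → Agree (e ∷ es) ω ω′
    agree-tail {e} {ω = ω} b agree e′ e′∉ =
      trans (sym (update-other ω {e} {e′} b (λ { refl → e′∉ (here refl) }))) (agree e′ (λ e′∈ → e′∉ (there e′∈)))

  -- Only assignments that agree with `ω` off `es` are ever evaluated. This lets bits that are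
  -- already drawn be treated as constants.
  E-mono-agree : ∀ es {f g} ω → (∀ ω′ → Agree es ω ω′ → f ω′ ≤ g ω′) → E es f ω ≤ E es g ω
  E-mono-agree []       ω f≤g = f≤g ω (λ _ _ → refl)
  E-mono-agree (e ∷ es) ω f≤g = mix-mono (branch true) (branch false)
    where
    branch : ∀ b → E es _ (ω [ e ≔ b ]) ≤ E es _ (ω [ e ≔ b ])
    branch b = E-mono-agree es (ω [ e ≔ b ]) (λ ω′ agree → f≤g ω′ (agree-tail b agree))

  E-mono : ∀ es {f g} ω → (∀ ω′ → f ω′ ≤ g ω′) → E es f ω ≤ E es g ω
  E-mono es ω f≤g = E-mono-agree es ω (λ ω′ _ → f≤g ω′)

  E-cong-agree : ∀ es {f g} ω → (∀ ω′ → Agree es ω ω′ → f ω′ ≡ g ω′) → E es f ω ≡ E es g ω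
  E-cong-agree es ω f≡g = ≤-antisym
    (E-mono-agree es ω (λ ω′ agree → ≤-reflexive (f≡g ω′ agree)))
    (E-mono-agree es ω (λ ω′ agree → ≤-reflexive (sym (f≡g ω′ agree))))

  E-cong : ∀ es {f g} ω → f ≗ g → E es f ω ≡ E es g ω
  E-cong es ω f≗g = E-cong-agree es ω (λ ω′ _ → f≗g ω′)

  E-const : ∀ es c ω → E es (λ _ → c) ω ≡ c
  E-const []       c ω = refl
  E-const (e ∷ es) c ω = trans (cong₂ mix (E-const es c _) (E-const es c _)) (mix-const c)

  E-≤const : ∀ es {f c} ω → (∀ ω′ → Agree es ω ω′ → f ω′ ≤ c) → E es f ω ≤ c
  E-≤const es {c = c} ω f≤c = ≤-trans (E-mono-agree es ω f≤c) (≤-reflexive (E-const es c ω))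

  E-+ : ∀ es f g ω → E es (λ ω′ → f ω′ + g ω′) ω ≡ E es f ω + E es g ω
  E-+ []       f g ω = refl
  E-+ (e ∷ es) f g ω = trans (cong₂ mix (E-+ es f g _) (E-+ es f g _)) (mix-+ _ _ _ _)

  E-* : ∀ es c f ω → E es (λ ω′ → c * f ω′) ω ≡ c * E es f ω
  E-* []       c f ω = refl
  E-* (e ∷ es) c f ω = trans (cong₂ mix (E-* es c f _) (E-* es c f _)) (mix-* c _ _)

  E-++ : ∀ es es′ f ω → E (es ++ es′) f ω ≡ E es (E es′ f) ω
  E-++ []       es′ f ω = refl
  E-++ (e ∷ es) es′ f ω = cong₂ mix (E-++ es es′ f _) (E-++ es es′ f _)

  E-ext : ∀ es {f} → Ext f → Ext (E es f)
  E-ext []       ext eq = ext eq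
  E-ext (e ∷ es) ext eq = cong₂ mix (E-ext es ext (update-cong e true eq)) (E-ext es ext (update-cong e false eq))

  E-swap : ∀ e₁ e₂ es {f} → Ext f → ∀ ω → E (e₁ ∷ e₂ ∷ es) f ω ≡ E (e₂ ∷ e₁ ∷ es) f ω
  E-swap e₁ e₂ es ext ω with e₁ ≟ₑ e₂
  ... | yes refl = refl
  ... | no e₁≢e₂ = trans
    (cong₂ mix (cong₂ mix (comm true true) (comm true false)) (cong₂ mix (comm false true) (comm false false)))
    (mix-swap _ _ _ _)
    where
    comm : ∀ b₁ b₂ → E es _ (ω [ e₁ ≔ b₁ ] [ e₂ ≔ b₂ ]) ≡ E es _ (ω [ e₂ ≔ b₂ ] [ e₁ ≔ b₁ ])
    comm b₁ b₂ = E-ext es ext (update-comm ω b₁ b₂ e₁≢e₂)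

  -- Repeated swaps carry the draw of `e` to the innermost place.
  E-rotate : ∀ e es {f} → Ext f → ∀ ω → E (e ∷ es) f ω ≡ E es (E (e ∷ []) f) ω
  E-rotate e []        ext ω = refl
  E-rotate e (e′ ∷ es) ext ω = trans (E-swap e e′ es ext ω) (cong₂ mix (E-rotate e es ext _) (E-rotate e es ext _))

  E-idem : ∀ e {f} → Ext f → ∀ ω → E (e ∷ e ∷ []) f ω ≡ E (e ∷ []) f ω
  E-idem e ext ω = trans
    (cong₂ mix (cong₂ mix (twice true true) (twice true false)) (cong₂ mix (twice false true) (twice false false)))
    (mix-const _)
    where
    twice : ∀ b b′ → _ ≡ _
    twice b b′ = ext (update-twice ω e b b′)

  -- The draw of `e` inside `es` is rotated inwards until it stands next to the extra draw, which
  -- overwrites it.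
  E-absorb : ∀ {e es f} → Ext f → e ∈ es → ∀ ω → E es (E (e ∷ []) f) ω ≡ E es f ω
  E-absorb {e} {_ ∷ es} {f} ext (here refl) ω = begin
    E (e ∷ es) (E (e ∷ []) f) ω   ≡⟨ E-rotate e es (E-ext (e ∷ []) ext) ω ⟩
    E es (E (e ∷ e ∷ []) f) ω     ≡⟨ E-cong es ω (E-idem e ext) ⟩
    E es (E (e ∷ []) f) ω         ≡⟨ E-rotate e es ext ω ⟨
    E (e ∷ es) f ω                ∎
    where open ≡-Reasoning
  E-absorb ext (there e∈es) ω = cong₂ mix (E-absorb ext e∈es _) (E-absorb ext e∈es _)

  -- Averaging first over part of the bits changes nothing, so a conditional bound given all the other bits is a bound.
  E-tower : ∀ {es} es′ {f} → Ext f → All (_∈ es) es′ → ∀ ω → E es (E es′ f) ω ≡ E es f ω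
  E-tower []        ext []            ω = refl
  E-tower {es} (e ∷ es′) ext (e∈es ∷ es′⊆es) ω =
    trans (E-absorb (E-ext es′ ext) e∈es ω) (E-tower es′ ext es′⊆es ω)

  E-≤-given : ∀ {es} es′ {f c} → Ext f → All (_∈ es) es′ → (∀ ω → E es′ f ω ≤ c) → ∀ ω → E es f ω ≤ c
  E-≤-given {es} es′ ext es′⊆es bound ω =
    ≤-trans (≤-reflexive (sym (E-tower es′ ext es′⊆es ω))) (E-≤const es ω (λ ω′ _ → bound ω′))

  Pr-∨ : ∀ es A B ω → Pr es (λ ω′ → A ω′ ∨ B ω′) ω ≤ Pr es A ω + Pr es B ω
  Pr-∨ es A B ω = ≤-trans (E-mono es ω (λ ω′ → ind-∨ (A ω′) (B ω′))) (≤-reflexive (E-+ es _ _ ω))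

  Pr-anyBelow : ∀ es n (A : ℕ → Ω → Bool) {c} ω → (∀ {k} → k ℕ.< n → Pr es (A k) ω ≤ c k) →
                Pr es (λ ω′ → anyBelow n (λ k → A k ω′)) ω ≤ sumBelow n c
  Pr-anyBelow es zero    A ω bound = ≤-reflexive (E-const es 0ℚ ω)
  Pr-anyBelow es (suc n) A ω bound = ≤-trans (Pr-∨ es (A n) (λ ω′ → anyBelow n (λ k → A k ω′)) ω)
    (+-mono-≤ (bound ℕ.≤-refl) (Pr-anyBelow es n A ω (λ k<n → bound (ℕ.m<n⇒m<1+n k<n))))

  module Reindex (φ : Edge → Edge) (involutive : ∀ e → φ (φ e) ≡ e) where

    update-φ : ∀ ω e b → (ω [ e ≔ b ]) ∘ φ ≗ (ω ∘ φ) [ φ e ≔ b ]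
    update-φ ω e b e′ with e ≟ₑ φ e′ | φ e ≟ₑ e′
    ... | yes _    | yes _    = refl
    ... | no _     | no _     = refl
    ... | yes refl | no ≢e′   = contradiction (involutive e′) ≢e′
    ... | no ≢φe′  | yes refl = contradiction (sym (involutive e)) ≢φe′

    -- Invariance of the product measure under a permutation of the bits: setting bit `e` and then
    -- reading through `φ` amounts to setting bit `φ e`.
    E-reindex : ∀ es {f} → Ext f → ∀ ω → E es (λ ω′ → f (ω′ ∘ φ)) ω ≡ E (map φ es) f (ω ∘ φ)
    E-reindex []       ext ω = refl
    E-reindex (e ∷ es) {f} ext ω = cong₂ mix (branch true) (branch false)
      where
      branch : ∀ b → E es (λ ω′ → f (ω′ ∘ φ)) (ω [ e ≔ b ]) ≡ E (map φ es) f ((ω ∘ φ) [ φ e ≔ b ])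
      branch b = trans (E-reindex es ext _) (E-ext (map φ es) ext (update-φ ω e b))

-- The Condorcet model as a product of bits

sumOver : ∀ {A : Set} → (A → ℚ) → List A → ℚ
sumOver f = foldr (λ x acc → f x + acc) 0ℚ

sumOver-++ : ∀ {A : Set} (f : A → ℚ) xs ys → sumOver f (xs ++ ys) ≡ sumOver f xs + sumOver f ys
sumOver-++ f []       ys = sym (+-identityˡ _)
sumOver-++ f (x ∷ xs) ys = trans (cong (_+_ (f x)) (sumOver-++ f xs ys)) (sym (+-assoc (f x) (sumOver f xs) (sumOver f ys)))

sumOver-concatMap : ∀ {A B : Set} (f : B → ℚ) (g : A → List B) xs → sumOver f (concatMap g xs) ≡ sumOver (λ x → sumOver f (g x)) xs
sumOver-concatMap f g []       = refl
sumOver-concatMap f g (x ∷ xs) = trans (sumOver-++ f (g x) (concatMap g xs)) (cong (_+_ (sumOver f (g x))) (sumOver-concatMap f g xs))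

sumOver-map : ∀ {A B : Set} (f : B → ℚ) (g : A → B) xs → sumOver f (map g xs) ≡ sumOver (λ x → f (g x)) xs
sumOver-map f g []       = refl
sumOver-map f g (x ∷ xs) = cong (_+_ (f (g x))) (sumOver-map f g xs)

sumOver-cong : ∀ {A : Set} {f g : A → ℚ} → f ≗ g → sumOver f ≗ sumOver g
sumOver-cong f≗g []       = refl
sumOver-cong f≗g (x ∷ xs) = cong₂ _+_ (f≗g x) (sumOver-cong f≗g xs)

sumOver-* : ∀ {A : Set} c (f : A → ℚ) xs → sumOver (λ x → c * f x) xs ≡ c * sumOver f xs
sumOver-* c f []       = sym (*-zeroʳ c)
sumOver-* c f (x ∷ xs) = trans (cong (_+_ (c * f x)) (sumOver-* c f xs)) (lemma c (f x) (sumOver f xs))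
  where
  lemma : ∀ c x y → c * x + c * y ≡ c * (x + y)
  lemma = solve-∀ ℚ-ring

rowVec : Ω → ℕ → ℕ → ∀ m → Vec Bool m
rowVec ω o c zero    = []
rowVec ω o c (suc m) = ω (o , c) ∷ rowVec ω o (suc c) m

rowEdges : ℕ → ℕ → ℕ → List Edge
rowEdges o c zero    = []
rowEdges o c (suc m) = (o , c) ∷ rowEdges o (suc c) m

-- Row o of ω is the newest, hence weakest, alternative.
toTournament : Ω → ℕ → ∀ n → Tournament n
toTournament ω o zero    = tt
toTournament ω o (suc n) = toTournament ω (suc o) n , rowVec ω o (suc o) n

allEdges : ℕ → ℕ → List Edge
allEdges o zero    = []
allEdges o (suc n) = allEdges (suc o) n ++ rowEdges o (suc o) n

rowEdges-≡ : ∀ {o c m i j} → (i , j) ∈ rowEdges o c m → i ≡ o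
rowEdges-≡ {m = suc m} (here refl) = refl
rowEdges-≡ {m = suc m} (there e∈)  = rowEdges-≡ {m = m} e∈

rowEdges-≥ : ∀ {o c m i j} → (i , j) ∈ rowEdges o c m → c ℕ.≤ j
rowEdges-≥ {m = suc m} (here refl) = ℕ.≤-refl
rowEdges-≥ {m = suc m} (there e∈)  = ℕ.<⇒≤ (rowEdges-≥ {m = m} e∈)

∈-rowEdges : ∀ {o c m j} → c ℕ.≤ j → j ℕ.< c ℕ.+ m → (o , j) ∈ rowEdges o c m
∈-rowEdges {c = c} {zero} c≤j j<c+0 rewrite ℕ.+-identityʳ c with () ← ℕ.<⇒≱ j<c+0 c≤j
∈-rowEdges {c = c} {suc m} {j} c≤j j<c+1+m with c ℕ.≟ j
... | yes refl = here refl
... | no c≢j   = there (∈-rowEdges (ℕ.≤∧≢⇒< c≤j c≢j) (subst (j ℕ.<_) (ℕ.+-suc c m) j<c+1+m))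

∈-allEdges : ∀ {o n i j} → o ℕ.≤ i → i ℕ.< j → j ℕ.< o ℕ.+ n → (i , j) ∈ allEdges o n
∈-allEdges {o} {zero} o≤i i<j j<o+0 rewrite ℕ.+-identityʳ o with () ← ℕ.<⇒≱ j<o+0 (ℕ.≤-trans o≤i (ℕ.<⇒≤ i<j))
∈-allEdges {o} {suc n} {i} {j} o≤i i<j j<o+1+n with o ℕ.≟ i
... | yes refl = ∈-++⁺ʳ (allEdges (suc o) n) (∈-rowEdges i<j (subst (j ℕ.<_) (ℕ.+-suc o n) j<o+1+n))
... | no o≢i   = ∈-++⁺ˡ (∈-allEdges (ℕ.≤∧≢⇒< o≤i o≢i) i<j (subst (j ℕ.<_) (ℕ.+-suc o n) j<o+1+n))

rowVec-cong : ∀ {ω ω′ o} c m → (∀ j → ω (o , j) ≡ ω′ (o , j)) → rowVec ω o c m ≡ rowVec ω′ o c m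
rowVec-cong c zero    eq = refl
rowVec-cong c (suc m) eq = cong₂ _∷_ (eq c) (rowVec-cong (suc c) m eq)

toTournament-cong : ∀ {ω ω′} o n → (∀ i j → o ℕ.≤ i → ω (i , j) ≡ ω′ (i , j)) → toTournament ω o n ≡ toTournament ω′ o n
toTournament-cong o zero    eq = refl
toTournament-cong o (suc n) eq = cong₂ _,_
  (toTournament-cong (suc o) n (λ i j o<i → eq i j (ℕ.<⇒≤ o<i)))
  (rowVec-cong (suc o) n (λ j → eq o j ℕ.≤-refl))

lookup-rowVec : ∀ ω o c {m} (j : Fin m) → lookup (rowVec ω o c m) j ≡ ω (o , c ℕ.+ toℕ j)
lookup-rowVec ω o c zero    = cong (λ k → ω (o , k)) (sym (ℕ.+-identityʳ c))
lookup-rowVec ω o c (suc j) = trans (lookup-rowVec ω o (suc c) j) (cong (λ k → ω (o , k)) (sym (ℕ.+-suc c (toℕ j))))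

dom-< : ∀ ω o {n} (i j : Fin n) → toℕ i ℕ.< toℕ j → dom (toTournament ω o n) i j ≡ ω (o ℕ.+ toℕ i , o ℕ.+ toℕ j)
dom-< ω o zero    (suc j) _   = trans (lookup-rowVec ω o (suc o) j) (cong₂ (λ a b → ω (a , b)) (sym (ℕ.+-identityʳ o)) (sym (ℕ.+-suc o (toℕ j))))
dom-< ω o (suc i) (suc j) i<j = trans (dom-< ω (suc o) i j (ℕ.s<s⁻¹ i<j)) (cong₂ (λ a b → ω (a , b)) (sym (ℕ.+-suc o (toℕ i))) (sym (ℕ.+-suc o (toℕ j))))

dom-> : ∀ ω o {n} (i j : Fin n) → toℕ j ℕ.< toℕ i → dom (toTournament ω o n) i j ≡ not (ω (o ℕ.+ toℕ j , o ℕ.+ toℕ i))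
dom-> ω o (suc i) zero    _   = cong not (trans (lookup-rowVec ω o (suc o) i) (cong₂ (λ a b → ω (a , b)) (sym (ℕ.+-identityʳ o)) (sym (ℕ.+-suc o (toℕ i)))))
dom-> ω o (suc i) (suc j) j<i = trans (dom-> ω (suc o) i j (ℕ.s<s⁻¹ j<i)) (cong not (cong₂ (λ a b → ω (a , b)) (sym (ℕ.+-suc o (toℕ j))) (sym (ℕ.+-suc o (toℕ i)))))

module Model (p : ℚ) (0≤p : 0ℚ ≤ p) (p≤1 : p ≤ 1ℚ) where

  open Expectation p 0≤p p≤1

  E-row : ∀ m o c (g : Vec Bool m → ℚ) ω →
          E (rowEdges o c m) (λ ω′ → g (rowVec ω′ o c m)) ω ≡ sumOver (λ v → vecWeight p v * g v) (allVec m)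
  E-row zero    o c g ω = lemma (g [])
    where
    lemma : ∀ x → x ≡ 1ℚ * x + 0ℚ
    lemma = solve-∀ ℚ-ring
  E-row (suc m) o c g ω = begin
    mix (inner true) (inner false)
      ≡⟨ cong₂ mix (branch true) (branch false) ⟩
    mix (sumOver (λ v → vecWeight p v * g (true ∷ v)) (allVec m)) (sumOver (λ v → vecWeight p v * g (false ∷ v)) (allVec m))
      ≡⟨ split (allVec m) ⟨
    sumOver (λ v → sumOver h ((true ∷ v) ∷ (false ∷ v) ∷ [])) (allVec m)
      ≡⟨ sumOver-concatMap h (λ v → (true ∷ v) ∷ (false ∷ v) ∷ []) (allVec m) ⟨
    sumOver h (allVec (suc m)) ∎
    where
    open ≡-Reasoning
    h : Vec Bool (suc m) → ℚ
    h v = vecWeight p v * g v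
    inner : Bool → ℚ
    inner b = E (rowEdges o (suc c) m) (λ ω′ → g (rowVec ω′ o c (suc m))) (ω [ o , c ≔ b ])
    -- The remaining columns start at `suc c`, so the bit at column `c` is not redrawn and can be
    -- replaced by `b`.
    branch : ∀ b → inner b ≡ sumOver (λ v → vecWeight p v * g (b ∷ v)) (allVec m)
    branch b = trans
      (E-cong-agree (rowEdges o (suc c) m) (ω [ o , c ≔ b ]) (λ ω′ agree → cong (λ b′ → g (b′ ∷ rowVec ω′ o (suc c) m))
        (trans (sym (agree (o , c) (λ e∈ → ℕ.<-irrefl refl (rowEdges-≥ {m = m} e∈)))) (update-same ω (o , c) b))))
      (E-row m o (suc c) (λ v → g (b ∷ v)) _)
    split : ∀ vs → sumOver (λ v → sumOver h ((true ∷ v) ∷ (false ∷ v) ∷ [])) vs ≡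
            mix (sumOver (λ v → vecWeight p v * g (true ∷ v)) vs) (sumOver (λ v → vecWeight p v * g (false ∷ v)) vs)
    split []       = sym (mix-const 0ℚ)
    split (v ∷ vs) = trans (cong (_+_ (sumOver h ((true ∷ v) ∷ (false ∷ v) ∷ []))) (split vs))
      (lemma p (vecWeight p v) (g (true ∷ v)) (g (false ∷ v)) _ _)
      where
      lemma : ∀ p w a b x y → p * w * a + ((1ℚ - p) * w * b + 0ℚ) + (p * x + (1ℚ - p) * y) ≡ p * (w * a + x) + (1ℚ - p) * (w * b + y)
      lemma = solve-∀ ℚ-ring

  E-tournament : ∀ n o (g : Tournament n → ℚ) ω →
                 E (allEdges o n) (λ ω′ → g (toTournament ω′ o n)) ω ≡ sumOver (λ t → weight p t * g t) (allT n)
  E-tournament zero    o g ω = lemma (g tt)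
    where
    lemma : ∀ x → x ≡ 1ℚ * x + 0ℚ
    lemma = solve-∀ ℚ-ring
  E-tournament (suc n) o g ω = begin
    E (allEdges (suc o) n ++ row) (λ ω′ → g (toTournament ω′ o (suc n))) ω
      ≡⟨ E-++ (allEdges (suc o) n) row _ ω ⟩
    E (allEdges (suc o) n) (E row (λ ω′ → g (toTournament ω′ o (suc n)))) ω
      ≡⟨ E-cong (allEdges (suc o) n) ω freeze ⟩
    E (allEdges (suc o) n) (λ ω′ → G (toTournament ω′ (suc o) n)) ω
      ≡⟨ E-tournament n (suc o) G ω ⟩
    sumOver (λ t → weight p t * G t) (allT n)
      ≡⟨ sumOver-cong flatten (allT n) ⟩
    sumOver (λ t → sumOver h (map (λ v → t , v) (allVec n))) (allT n)
      ≡⟨ sumOver-concatMap h (λ t → map (λ v → t , v) (allVec n)) (allT n) ⟨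
    sumOver h (allT (suc n)) ∎
    where
    open ≡-Reasoning
    row = rowEdges o (suc o) n
    h : Tournament (suc n) → ℚ
    h t = weight p t * g t
    G : Tournament n → ℚ
    G t = sumOver (λ v → vecWeight p v * g (t , v)) (allVec n)
    -- The older alternatives read only rows with index above `o`, so their tournament stays
    -- constant while row `o` is redrawn.
    freeze : ∀ ω₁ → E row (λ ω′ → g (toTournament ω′ o (suc n))) ω₁ ≡ G (toTournament ω₁ (suc o) n)
    freeze ω₁ = trans
      (E-cong-agree row ω₁ (λ ω′ agree → cong (λ t → g (t , rowVec ω′ o (suc o) n))
        (toTournament-cong (suc o) n (λ i j o<i → sym (agree (i , j) (λ e∈ → ℕ.<-irrefl (sym (rowEdges-≡ {m = n} e∈)) o<i))))))
      (E-row n o (suc o) (λ v → g (toTournament ω₁ (suc o) n , v)) ω₁)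
    flatten : ∀ t → weight p t * G t ≡ sumOver h (map (λ v → t , v) (allVec n))
    flatten t = begin
      weight p t * G t
        ≡⟨ sumOver-* (weight p t) (λ v → vecWeight p v * g (t , v)) (allVec n) ⟨
      sumOver (λ v → weight p t * (vecWeight p v * g (t , v))) (allVec n)
        ≡⟨ sumOver-cong (λ v → lemma (weight p t) (vecWeight p v) (g (t , v))) (allVec n) ⟩
      sumOver (λ v → h (t , v)) (allVec n)
        ≡⟨ sumOver-map h (λ v → t , v) (allVec n) ⟨
      sumOver h (map (λ v → t , v) (allVec n)) ∎
      where
      lemma : ∀ a b c → a * (b * c) ≡ a * b * c
      lemma = solve-∀ ℚ-ring

  -- Every bit that the tournament reads is redrawn, so the starting assignment `ω` is arbitrary.
  Prob-≡-Pr : ∀ n (P : Pred (Tournament n) Level.zero) (P? : Decidable P) ω →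
              Prob n p P P? ≡ Pr (allEdges 0 n) (λ ω′ → does (P? (toTournament ω′ 0 n))) ω
  Prob-≡-Pr n P P? ω = trans (sumOver-cong indicator (allT n)) (sym (E-tournament n 0 (λ t → ind (does (P? t))) ω))
    where
    indicator : ∀ t → (if does (P? t) then weight p t else 0ℚ) ≡ weight p t * ind (does (P? t))
    indicator t with does (P? t)
    ... | true  = sym (*-identityʳ (weight p t))
    ... | false = sym (*-zeroʳ (weight p t))

-- Failure events on one side of the order

∧-false : ∀ {a b} → a ∧ b ≡ false → a ≡ false ⊎ b ≡ false
∧-false {false} _  = inj₁ refl
∧-false {true}  eq = inj₂ eq

∨-false : ∀ {a b} → a ∨ b ≡ false → a ≡ false × b ≡ false
∨-false {false} eq = refl , eq

remove : ℕ → List ℕ → List ℕ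
remove x = filter (λ u → ¬? (u ℕ.≟ x))

length-remove : ∀ x {S} → Unique S → length S ℕ.≤ suc (length (remove x S))
length-remove x {[]}    _ = ℕ.z≤n
length-remove x {u ∷ S} (u∉S ∷ uS) with u ℕ.≟ x
... | yes refl rewrite filter-reject (λ v → ¬? (v ℕ.≟ u)) {xs = S} (λ u≢u → u≢u refl)
                     | filter-all (λ v → ¬? (v ℕ.≟ u)) (All.map (λ u≢v v≡u → u≢v (sym v≡u)) u∉S) = ℕ.≤-refl
... | no u≢x rewrite filter-accept (λ v → ¬? (v ℕ.≟ x)) {xs = S} u≢x = ℕ.s≤s (length-remove x uS)

findᵇ-cong : ∀ {f g : ℕ → Bool} → f ≗ g → ∀ xs → findᵇ f xs ≡ findᵇ g xs
findᵇ-cong f≗g []       = refl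
findᵇ-cong {f} {g} f≗g (x ∷ xs) rewrite f≗g x with g x
... | true  = refl
... | false = findᵇ-cong f≗g xs

findᵇ-just : ∀ {f : ℕ → Bool} xs {x} → findᵇ f xs ≡ just x → x ∈ xs × f x ≡ true
findᵇ-just {f} (y ∷ xs) eq with f y in fy
findᵇ-just {f} (y ∷ xs) refl | true  = here refl , fy
findᵇ-just {f} (y ∷ xs) eq   | false = let x∈ , fx = findᵇ-just xs eq in there x∈ , fx

findᵇ-nothing : ∀ {f : ℕ → Bool} xs {x} → findᵇ f xs ≡ nothing → x ∈ xs → f x ≡ false
findᵇ-nothing {f} (y ∷ xs) eq x∈ with f y in fy
findᵇ-nothing {f} (y ∷ xs) () x∈          | true
findᵇ-nothing {f} (y ∷ xs) eq (here refl) | false = fy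
findᵇ-nothing {f} (y ∷ xs) eq (there x∈)  | false = findᵇ-nothing xs eq x∈

none : Ω → ℕ → List ℕ → Bool
none ω i []      = true
none ω i (u ∷ S) = not (ω (i , u)) ∧ none ω i S

-- Candidate `i` is useless to `x`: either `x` cannot step down to it because it beats `x`, or it
-- has no upset over a member of `S`.
hop : Ω → ℕ → List ℕ → ℕ → Bool
hop ω x S i = ω (i , x) ∨ none ω i S

chain : Ω → ℕ → List ℕ → ℕ → Bool
chain ω x S zero    = true
chain ω x S (suc k) = hop ω x S k ∧ chain ω x S k

none-cong : ∀ {ω ω′ i} → (∀ v → ω (i , v) ≡ ω′ (i , v)) → ∀ S → none ω i S ≡ none ω′ i S
none-cong eq []      = refl
none-cong eq (u ∷ S) = cong₂ (λ a b → not a ∧ b) (eq u) (none-cong eq S)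

hop-cong : ∀ {ω ω′ i} x S → (∀ v → ω (i , v) ≡ ω′ (i , v)) → hop ω x S i ≡ hop ω′ x S i
hop-cong x S eq = cong₂ _∨_ (eq x) (none-cong eq S)

chain-cong : ∀ {ω ω′} x S k → ω ≗ ω′ → chain ω x S k ≡ chain ω′ x S k
chain-cong x S zero    eq = refl
chain-cong x S (suc k) eq = cong₂ _∧_ (hop-cong x S (λ v → eq (k , v))) (chain-cong x S k eq)

none-false : ∀ {ω i} S → none ω i S ≡ false → ∃[ u ] u ∈ S × ω (i , u) ≡ true
none-false {ω} {i} (u ∷ S) eq with ω (i , u) in ωiu
... | true  = u , here refl , ωiu
... | false = let v , v∈ , ωiv = none-false S eq in v , there v∈ , ωiv

chain-false : ∀ {ω x S} k → chain ω x S k ≡ false →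
              ∃[ i ] i ℕ.< k × ω (i , x) ≡ false × (∃[ u ] u ∈ S × ω (i , u) ≡ true)
chain-false {ω} {x} {S} (suc k) eq with ∧-false {hop ω x S k} eq
... | inj₁ hop-no = let ωkx , none-no = ∨-false hop-no in k , ℕ.≤-refl , ωkx , none-false S none-no
... | inj₂ chain-no = let i , i<k , rest = chain-false k chain-no in i , ℕ.m<n⇒m<1+n i<k , rest

chainEdges : ℕ → List ℕ → ℕ → List Edge
chainEdges x S zero    = []
chainEdges x S (suc k) = ((k , x) ∷ map (k ,_) S) ++ chainEdges x S k

∈-chainEdges⁻ : ∀ {x S i v} k → (i , v) ∈ chainEdges x S k → i ℕ.< k × (v ≡ x ⊎ v ∈ S)
∈-chainEdges⁻ {x} {S} (suc k) e∈ with ∈-++⁻ ((k , x) ∷ map (k ,_) S) e∈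
... | inj₁ (here refl) = ℕ.≤-refl , inj₁ refl
... | inj₁ (there e∈S) with v , v∈ , refl ← ∈-map⁻ (k ,_) e∈S = ℕ.≤-refl , inj₂ v∈
... | inj₂ e∈rest = let i<k , v∈ = ∈-chainEdges⁻ k e∈rest in ℕ.m<n⇒m<1+n i<k , v∈

-- Positions count from the weak end, and ω (i , j) with i < j tells whether i beats j. W consists of the positions s + t
-- with t < s; targets g t are the u ∈ U that beat s + t, and b = rev j is served by the first w ∈ W that beats it.
-- Only u ≠ x are used for x, so that the bits (i , x) and (i , u) are distinct.
module Events (q s n h : ℕ) where

  rev : ℕ → ℕ
  rev j = n ℕ.∸ suc j

  U : List ℕ
  U = map (h ℕ.+_) (upTo s)

  -- Inside A, `x` is itself a candidate besides the weaker positions, and `none` supplies the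
  -- factor δ. Outside A the candidates are all `s` members of A.
  fail : Ω → ℕ → List ℕ → Bool
  fail ω x S = if does (x ℕ.<? s) then none ω x S ∧ chain ω x S x else chain ω x S s

  targets : (ℕ → ℕ → Bool) → ℕ → List ℕ
  targets g t = filter (λ u → g t u Bool.≟ false) U

  -- The rows of W enter through the separate argument `g`, so that the hub and its targets can be
  -- held fixed while the bottom rows are redrawn. A hub with at most `q` targets gives `false`
  -- here; that case is charged to `scarce`.
  failVia : (ℕ → ℕ → Bool) → Ω → ℕ → ℕ → Bool
  failVia g ω x j = maybe′ (λ t → does (q ℕ.<? length (targets g t)) ∧ fail ω x (remove x (targets g t))) false
    (findᵇ (λ t → g t (rev j)) (upTo s))

  inner : Ω → ℕ → ℕ → Bool
  inner ω t v = ω (s ℕ.+ t , v)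

  scarce : Ω → ℕ → Bool
  scarce ω t = does (length (targets (inner ω) t) ℕ.≤? q)

  -- The bound `suc x ⊓ s` lets j run over the members of B, counted from the strong end, that are
  -- no farther from that end than `x` is from the weak end.
  stuck : Ω → ℕ → Bool
  stuck ω x = fail ω x (remove x U) ∨ anyBelow (suc x ℕ.⊓ s) (failVia (inner ω) ω x)

  bad : Ω → Bool
  bad ω = anyBelow n (stuck ω) ∨ anyBelow s (scarce ω)

  fail-cong : ∀ {ω ω′} x S → ω ≗ ω′ → fail ω x S ≡ fail ω′ x S
  fail-cong x S eq = cong₂ (if_then_else_ (does (x ℕ.<? s)))
    (cong₂ _∧_ (none-cong (λ v → eq (x , v)) S) (chain-cong x S x eq)) (chain-cong x S s eq)

  targets-cong : ∀ {g g′} t → (∀ t v → g t v ≡ g′ t v) → targets g t ≡ targets g′ t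
  targets-cong t eq = filter-≐ _ _ ((λ {u} → trans (sym (eq t u))) , (λ {u} → trans (eq t u))) U

  failVia-cong : ∀ {g g′ ω ω′} x j → (∀ t v → g t v ≡ g′ t v) → ω ≗ ω′ → failVia g ω x j ≡ failVia g′ ω′ x j
  failVia-cong {g} {g′} {ω} {ω′} x j geq eq
    rewrite findᵇ-cong {λ t → g t (rev j)} {λ t → g′ t (rev j)} (λ t → geq t (rev j)) (upTo s)
    with findᵇ (λ t → g′ t (rev j)) (upTo s)
  ... | nothing = refl
  ... | just t rewrite targets-cong t geq = cong (does (q ℕ.<? length (targets g′ t)) ∧_) (fail-cong x (remove x (targets g′ t)) eq)

  scarce-cong : ∀ {ω ω′} t → ω ≗ ω′ → scarce ω t ≡ scarce ω′ t
  scarce-cong t eq = cong (λ S → does (length S ℕ.≤? q)) (targets-cong t (λ t v → eq (s ℕ.+ t , v)))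

  stuck-cong : ∀ {ω ω′} x → ω ≗ ω′ → stuck ω x ≡ stuck ω′ x
  stuck-cong x eq = cong₂ _∨_ (fail-cong x (remove x U) eq)
    (anyBelow-cong (suc x ℕ.⊓ s) (λ j → failVia-cong x j (λ t v → eq (s ℕ.+ t , v)) eq))

  bad-cong : ∀ {ω ω′} → ω ≗ ω′ → bad ω ≡ bad ω′
  bad-cong eq = cong₂ _∨_ (anyBelow-cong n (λ x → stuck-cong x eq)) (anyBelow-cong s (λ t → scarce-cong t eq))

  ∈U⁻ : ∀ {u} → u ∈ U → h ℕ.≤ u × u ℕ.< h ℕ.+ s
  ∈U⁻ u∈ with t , t∈ , refl ← ∈-map⁻ (h ℕ.+_) u∈ = ℕ.m≤m+n h t , ℕ.+-monoʳ-< h (∈-upTo⁻ t∈)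

  U-unique : Unique U
  U-unique = map⁺ (ℕ.+-cancelˡ-≡ h _ _) (upTo⁺ s)

  length-U : length U ≡ s
  length-U = trans (length-map (h ℕ.+_) (upTo s)) (length-upTo s)

  Reach : Ω → ℕ → ℕ → Set
  Reach ω x i = i ℕ.< s × (i ≡ x ⊎ (i ℕ.< x × ω (i , x) ≡ false))

  fail-< : ∀ {ω x} S → x ℕ.< s → fail ω x S ≡ none ω x S ∧ chain ω x S x
  fail-< {x = x} S x<s rewrite dec-true (x ℕ.<? s) x<s = refl

  fail-≥ : ∀ {ω x} S → x ℕ.≮ s → fail ω x S ≡ chain ω x S s
  fail-≥ {x = x} S x≮s rewrite dec-false (x ℕ.<? s) x≮s = refl

  fail-false : ∀ {ω} x S → fail ω x S ≡ false → ∃[ i ] Reach ω x i × (∃[ u ] u ∈ S × ω (i , u) ≡ true)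
  fail-false {ω} x S eq with x ℕ.<? s
  ... | no x≮s with i , i<s , ωix , up ← chain-false s (trans (sym (fail-≥ {ω} S x≮s)) eq) =
    i , (i<s , inj₂ (ℕ.<-≤-trans i<s (ℕ.≮⇒≥ x≮s) , ωix)) , up
  ... | yes x<s with ∧-false {none ω x S} (trans (sym (fail-< {ω} S x<s)) eq)
  ...   | inj₁ none-no = x , (x<s , inj₁ refl) , none-false S none-no
  ...   | inj₂ chain-no with i , i<x , ωix , up ← chain-false x chain-no =
    i , (ℕ.<-trans i<x x<s , inj₂ (i<x , ωix)) , up

  record Linked (ω : Ω) (x j : ℕ) : Set where
    field
      {a u w} : ℕ
      reach   : Reach ω x a
      u≥      : h ℕ.≤ u
      u<      : u ℕ.< h ℕ.+ s
      w≥      : s ℕ.≤ w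
      w<      : w ℕ.< s ℕ.+ s
      a-u     : ω (a , u) ≡ true
      u-w     : ω (w , u) ≡ false
      w-b     : ω (w , rev j) ≡ true

  good-reach : ∀ {ω} → bad ω ≡ false → ∀ {x} → x ℕ.< n →
               ∃[ a ] Reach ω x a × (∃[ u ] h ℕ.≤ u × u ℕ.< h ℕ.+ s × ω (a , u) ≡ true)
  good-reach {ω} ok {x} x<n
    with a , r , u , u∈ , a-u ← fail-false x (remove x U) (proj₁ (∨-false (anyBelow-false n (proj₁ (∨-false ok)) x<n)))
    with u≥ , u< ← ∈U⁻ (proj₁ (∈-filter⁻ _ u∈)) = a , r , u , u≥ , u< , a-u

  -- The given upset over `rev j` only guarantees that the search for a hub succeeds; the hub found
  -- may be another one. It is not scarce, so the absence of `failVia` yields a candidate of `x`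
  -- with an upset over one of its targets.
  good-linked : ∀ {ω} → bad ω ≡ false → ∀ {x j t} → x ℕ.< n → j ℕ.< s → j ℕ.≤ x → t ℕ.< s →
                ω (s ℕ.+ t , rev j) ≡ true → Linked ω x j
  good-linked {ω} ok {x} {j} {t₀} x<n j<s j≤x t₀<s up = find-hub _ refl
    where
    no-fail : failVia (inner ω) ω x j ≡ false
    no-fail = anyBelow-false (suc x ℕ.⊓ s) (proj₂ (∨-false {fail ω x (remove x U)} (anyBelow-false n (proj₁ (∨-false ok)) x<n)))
      (ℕ.⊓-pres-m< (ℕ.s≤s j≤x) j<s)
    plenty : ∀ {t} → t ℕ.< s → q ℕ.< length (targets (inner ω) t)
    plenty {t} t<s = ℕ.≰⇒> (λ ≤q → case-false (trans (sym (dec-true (length (targets (inner ω) t) ℕ.≤? q) ≤q))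
      (anyBelow-false s (proj₂ (∨-false {anyBelow n (stuck ω)} ok)) t<s)))
      where
      case-false : true ≢ false
      case-false ()
    find-hub : ∀ m → findᵇ (λ t → ω (s ℕ.+ t , rev j)) (upTo s) ≡ m → Linked ω x j
    find-hub nothing eq with () ← trans (sym up) (findᵇ-nothing (upTo s) eq (∈-upTo⁺ t₀<s))
    find-hub (just t) eq
      with t∈ , w-b ← findᵇ-just (upTo s) eq
      with a , r , u , u∈ , a-u ← fail-false x (remove x (targets (inner ω) t))
        (trans (cong (_∧ fail ω x (remove x (targets (inner ω) t))) (sym (dec-true (q ℕ.<? _) (plenty (∈-upTo⁻ t∈)))))
          (trans (cong (maybe′ _ false) (sym eq)) no-fail))
      with u∈U , u-w ← ∈-filter⁻ (λ u → inner ω t u Bool.≟ false) {xs = U} (proj₁ (∈-filter⁻ _ u∈))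
      with u≥ , u< ← ∈U⁻ u∈U = record
        { reach = r ; u≥ = u≥ ; u< = u< ; w≥ = ℕ.m≤m+n s t ; w< = ℕ.+-monoʳ-< s (∈-upTo⁻ t∈)
        ; a-u = a-u ; u-w = u-w ; w-b = w-b }

-- Probability bounds for the failure events

module Bounds (p : ℚ) (0≤p : 0ℚ ≤ p) (p≤½ : p ≤ ½) where

  p≤1 : p ≤ 1ℚ
  p≤1 = ≤-trans p≤½ (≤ᵇ⇒≤ _)

  open Expectation p 0≤p p≤1

  p̄≤1 : p̄ ≤ 1ℚ
  p̄≤1 = ≤-byDiff (lemma p) 0≤p
    where
    lemma : ∀ p → 1ℚ ≡ 1ℚ - p + p
    lemma = solve-∀ ℚ-ring

  -- Once `es` is drawn, redrawing `es′` does not affect `A`, so its indicator is a constant factor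
  -- of the inner expectation. `B` may depend on `es`, because its bound is uniform in `ω`.
  Pr-∧ : ∀ es es′ A B {a b} → 0ℚ ≤ b → (∀ ω ω′ → Agree es′ ω ω′ → A ω ≡ A ω′) →
         (∀ ω → Pr es A ω ≤ a) → (∀ ω → Pr es′ B ω ≤ b) →
         ∀ ω → Pr (es ++ es′) (λ ω′ → A ω′ ∧ B ω′) ω ≤ a * b
  Pr-∧ es es′ A B {a} {b} 0≤b local boundA boundB ω = begin
    Pr (es ++ es′) (λ ω′ → A ω′ ∧ B ω′) ω              ≡⟨ E-++ es es′ _ ω ⟩
    E es (Pr es′ (λ ω′ → A ω′ ∧ B ω′)) ω               ≤⟨ E-mono es ω inner ⟩
    E es (λ ω₁ → b * ind (A ω₁)) ω                     ≡⟨ E-* es b (λ ω₁ → ind (A ω₁)) ω ⟩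
    b * Pr es A ω                                      ≤⟨ *-monoˡ 0≤b (boundA ω) ⟩
    b * a                                              ≡⟨ *-comm b a ⟩
    a * b                                              ∎
    where
    open ≤-Reasoning
    inner : ∀ ω₁ → Pr es′ (λ ω′ → A ω′ ∧ B ω′) ω₁ ≤ b * ind (A ω₁)
    inner ω₁ = begin
      Pr es′ (λ ω′ → A ω′ ∧ B ω′) ω₁                   ≡⟨ E-cong-agree es′ ω₁ (λ ω′ agree →
        trans (ind-∧ (A ω′) (B ω′)) (cong (λ c → ind c * ind (B ω′)) (sym (local ω₁ ω′ agree)))) ⟩
      E es′ (λ ω′ → ind (A ω₁) * ind (B ω′)) ω₁        ≡⟨ E-* es′ (ind (A ω₁)) (λ ω′ → ind (B ω′)) ω₁ ⟩
      ind (A ω₁) * Pr es′ B ω₁                         ≤⟨ *-monoˡ (0≤ind (A ω₁)) (boundB ω₁) ⟩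
      ind (A ω₁) * b                                   ≡⟨ *-comm (ind (A ω₁)) b ⟩
      b * ind (A ω₁)                                   ∎

  edge∉ : ∀ {i u : ℕ} {S} → All (u ≢_) S → (i , u) ∉ map (i ,_) S
  edge∉ {i} u∉S e∈ with v , v∈ , refl ← ∈-map⁻ (i ,_) e∈ = All.lookup u∉S v∈ refl

  Pr-none : ∀ i {S} → Unique S → ∀ ω → Pr (map (i ,_) S) (λ ω′ → none ω′ i S) ω ≤ p̄ ^ length S
  Pr-none i {[]}    _          ω = ≤-refl
  Pr-none i {u ∷ S} (u∉S ∷ uS) ω = begin
    Pr (map (i ,_) (u ∷ S)) (λ ω′ → none ω′ i (u ∷ S)) ω
      ≤⟨ mix-mono {x′ = 0ℚ}
           (E-≤const (map (i ,_) S) _ (λ ω′ agree → ≤-reflexive (cong (λ b → ind (not b ∧ none ω′ i S)) (value true agree))))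
           (≤-trans (E-mono-agree (map (i ,_) S) _ (λ ω′ agree → ≤-reflexive (cong (λ b → ind (not b ∧ none ω′ i S)) (value false agree))))
             (Pr-none i uS _)) ⟩
    mix 0ℚ (p̄ ^ length S)
      ≡⟨ lemma p p̄ (p̄ ^ length S) ⟩
    p̄ * p̄ ^ length S ∎
    where
    open ≤-Reasoning
    value : ∀ b {ω′} → Agree (map (i ,_) S) (ω [ i , u ≔ b ]) ω′ → ω′ (i , u) ≡ b
    value b agree = trans (sym (agree (i , u) (edge∉ u∉S))) (update-same ω (i , u) b)
    lemma : ∀ p p̄ x → p * 0ℚ + p̄ * x ≡ p̄ * x
    lemma = solve-∀ ℚ-ring

  -- The bit `(i , x)` is drawn first. If it is `true` the bound is 1; if it is `false` the event
  -- reduces to `none`, and `x ∉ S` keeps that bit from being redrawn.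
  Pr-hop : ∀ i {x S} → Unique S → x ∉ S → ∀ ω → Pr ((i , x) ∷ map (i ,_) S) (λ ω′ → hop ω′ x S i) ω ≤ mix 1ℚ (p̄ ^ length S)
  Pr-hop i {x} {S} uS x∉S ω = mix-mono
    (E-≤const (map (i ,_) S) _ (λ ω′ _ → ind-≤1 (hop ω′ x S i)))
    (≤-trans (E-mono-agree (map (i ,_) S) _ (λ ω′ agree → ≤-reflexive (cong (λ b → ind (b ∨ none ω′ i S)) (value agree))))
      (Pr-none i uS _))
    where
    value : ∀ {ω′} → Agree (map (i ,_) S) (ω [ i , x ≔ false ]) ω′ → ω′ (i , x) ≡ false
    value agree = trans (sym (agree (i , x) (edge∉ (All.tabulate (λ v∈ x≡v → x∉S (subst (_∈ S) (sym x≡v) v∈)))))) (update-same ω (i , x) false)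

  -- The quantity p + (1-p)/2 increases with `p` and equals 3/4 at p = 1/2.
  mix-1-≤ρ : ∀ {y} → y ≤ ½ → mix 1ℚ y ≤ ρ
  mix-1-≤ρ {y} y≤½ = begin
    mix 1ℚ y      ≤⟨ mix-mono {1ℚ} {1ℚ} ≤-refl y≤½ ⟩
    mix 1ℚ ½      ≤⟨ ≤-byDiff (lemma p) (0≤* (≤ᵇ⇒≤ {0ℚ} {½} _) (0≤- p≤½)) ⟩
    ρ             ∎
    where
    open ≤-Reasoning
    lemma : ∀ p → ρ ≡ p * 1ℚ + (1ℚ - p) * ½ + ½ * (½ - p)
    lemma = solve-∀ ℚ-ring

  -- Distinct candidates use distinct rows, so their failures multiply.
  Pr-chain : ∀ k {x S} → Unique S → x ∉ S → p̄ ^ length S ≤ ½ → ∀ ω → Pr (chainEdges x S k) (λ ω′ → chain ω′ x S k) ω ≤ ρ ^ k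
  Pr-chain zero        uS x∉S small ω = ≤-refl
  Pr-chain (suc k) {x} {S} uS x∉S small ω = Pr-∧ ((k , x) ∷ map (k ,_) S) (chainEdges x S k) (λ ω′ → hop ω′ x S k) (λ ω′ → chain ω′ x S k)
    (^-nonNeg k 0≤ρ)
    (λ ω ω′ agree → hop-cong x S (λ v → agree (k , v) (λ e∈ → ℕ.<-irrefl refl (proj₁ (∈-chainEdges⁻ k e∈)))))
    (λ ω₁ → ≤-trans (Pr-hop k uS x∉S ω₁) (mix-1-≤ρ small))
    (Pr-chain k uS x∉S small) ω

  few : ℕ → ℕ → List ℕ → Ω → Bool
  few k i L ω = does (length (filter (λ u → ω (i , u) Bool.≟ false) L) ℕ.≤? k)

  -- The induction on L closes because p + (1-p)/4 ≤ 5/8 for p ≤ 1/2.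
  Pr-few : ∀ i k {L} → Unique L → ∀ ω → Pr (map (i ,_) L) (few k i L) ω ≤ ι 4 ^ k * (+ 5 / 8) ^ length L
  Pr-few i k {[]} _ ω = ≤-trans (ind-≤1 (few k i [] ω)) (≤-trans (1≤4^ k) (≤-reflexive (sym (*-identityʳ (ι 4 ^ k)))))
    where
    1≤4^ : ∀ k → 1ℚ ≤ ι 4 ^ k
    1≤4^ zero    = ≤-refl
    1≤4^ (suc k) = *-mono {1ℚ} {ι 4} {1ℚ} (0≤ι 4) 0≤1 (≤ᵇ⇒≤ _) (1≤4^ k)
  Pr-few i k {u ∷ L} (u∉L ∷ uL) ω = begin
    Pr (map (i ,_) (u ∷ L)) (few k i (u ∷ L)) ω
      ≤⟨ mix-mono {x′ = ι 4 ^ k * c} {y′ = + 1 / 4 * (ι 4 ^ k * c)} (≤-trans up (Pr-few i k uL _)) (down k) ⟩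
    mix (ι 4 ^ k * c) (+ 1 / 4 * (ι 4 ^ k * c))
      ≤⟨ ≤-byDiff (lemma p (ι 4 ^ k) c) (0≤* (≤ᵇ⇒≤ {0ℚ} {+ 3 / 4} _) (0≤* (0≤- p≤½) (0≤* (^-nonNeg k (0≤ι 4)) 0≤c))) ⟩
    ι 4 ^ k * (+ 5 / 8 * c) ∎
    where
    open ≤-Reasoning
    c = (+ 5 / 8) ^ length L
    0≤c : 0ℚ ≤ c
    0≤c = ^-nonNeg (length L) (≤ᵇ⇒≤ _)
    lemma : ∀ p a c → a * (+ 5 / 8 * c) ≡ p * (a * c) + (1ℚ - p) * (+ 1 / 4 * (a * c)) + + 3 / 4 * ((½ - p) * (a * c))
    lemma = solve-∀ ℚ-ring
    value : ∀ b {ω′} → Agree (map (i ,_) L) (ω [ i , u ≔ b ]) ω′ → ω′ (i , u) ≡ b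
    value b agree = trans (sym (agree (i , u) (edge∉ u∉L))) (update-same ω (i , u) b)
    reject : ∀ {ω′} → ω′ (i , u) ≡ true → few k i (u ∷ L) ω′ ≡ few k i L ω′
    reject {ω′} eq rewrite filter-reject (λ u → ω′ (i , u) Bool.≟ false) {x = u} {xs = L} (λ eq′ → contradiction (trans (sym eq) eq′) (λ ())) = refl
    accept : ∀ {ω′} k → ω′ (i , u) ≡ false → few k i (u ∷ L) ω′ ≡ does (suc (length (filter (λ u → ω′ (i , u) Bool.≟ false) L)) ℕ.≤? k)
    accept {ω′} k eq rewrite filter-accept (λ u → ω′ (i , u) Bool.≟ false) {x = u} {xs = L} eq = refl
    up : E (map (i ,_) L) (λ ω′ → ind (few k i (u ∷ L) ω′)) (ω [ i , u ≔ true ]) ≤ Pr (map (i ,_) L) (few k i L) (ω [ i , u ≔ true ])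
    up = E-mono-agree (map (i ,_) L) _ (λ ω′ agree → ≤-reflexive (cong ind (reject {ω′} (value true agree))))
    down : ∀ k → E (map (i ,_) L) (λ ω′ → ind (few k i (u ∷ L) ω′)) (ω [ i , u ≔ false ]) ≤ + 1 / 4 * (ι 4 ^ k * c)
    -- With threshold 0 the event is impossible once `u` has been counted.
    down zero    = ≤-trans
      (E-≤const (map (i ,_) L) _ (λ ω′ agree → ≤-reflexive (cong ind (accept {ω′} zero (value false agree)))))
      (0≤* {+ 1 / 4} (≤ᵇ⇒≤ _) (0≤* 0≤1 0≤c))
    -- Counting `u` lowers the threshold by one, which turns 4^(k+1) into 4^k and yields the factor
    -- 1/4.
    down (suc k) = ≤-trans
      (E-mono-agree (map (i ,_) L) _ (λ ω′ agree → ≤-reflexive (cong ind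
        (trans (accept {ω′} (suc k) (value false agree)) (≤?-suc (length (filter (λ u → ω′ (i , u) Bool.≟ false) L)) k)))))
      (≤-trans (Pr-few i k uL _) (≤-reflexive (quarter (ι 4 ^ k) c)))
      where
      ≤?-suc : ∀ a k → does (suc a ℕ.≤? suc k) ≡ does (a ℕ.≤? k)
      ≤?-suc zero    k = refl
      ≤?-suc (suc a) k = refl
      quarter : ∀ a c → a * c ≡ + 1 / 4 * (ι 4 * a * c)
      quarter = solve-∀ ℚ-ring

  module OneSided (q s n h : ℕ) (s≡8q : s ≡ 8 ℕ.* q) (2s≤h : s ℕ.+ s ℕ.≤ h) (h+s≤n : h ℕ.+ s ℕ.≤ n) (small : p̄ ^ q ≤ ½) where

    open Events q s n h

    δ : ℚ
    δ = p̄ ^ q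

    0≤δ : 0ℚ ≤ δ
    0≤δ = ^-nonNeg q 0≤p̄

    -- Only bottom rows are required, so that the estimates also apply when nothing but
    -- `bottomEdges` is redrawn.
    Covers : List Edge → Set
    Covers es = ∀ {i j} → i ℕ.< s → i ℕ.< j → j ℕ.< n → (i , j) ∈ es

    cost : ℕ → ℚ
    cost x = if does (x ℕ.<? s) then δ * ρ ^ x else ρ ^ s

    0≤cost : ∀ x → 0ℚ ≤ cost x
    0≤cost x with does (x ℕ.<? s)
    ... | true  = 0≤* 0≤δ (^-nonNeg x 0≤ρ)
    ... | false = ^-nonNeg s 0≤ρ

    -- By `E-≤-given` it suffices to redraw the bits that the event reads. For `x` in A, row `x`
    -- gives δ and each of the `x` rows below it gives 3/4; otherwise the `s` bottom rows give 3/4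
    -- each.
    Pr-fail : ∀ {es} → Covers es → ∀ {x} → x ℕ.< n → ∀ {S} → Unique S → x ∉ S → (∀ {u} → u ∈ S → u ∈ U) → q ℕ.≤ length S →
              ∀ ω → Pr es (λ ω′ → fail ω′ x S) ω ≤ cost x
    Pr-fail {es} covers {x} x<n {S} uS x∉S S⊆U q≤S ω with x ℕ.<? s
    ... | yes x<s rewrite dec-true (x ℕ.<? s) x<s = E-≤-given (map (x ,_) S ++ chainEdges x S x)
      (λ eq → cong ind (cong₂ _∧_ (none-cong (λ v → eq (x , v)) S) (chain-cong x S x eq)))
      (All.tabulate sub)
      (Pr-∧ (map (x ,_) S) (chainEdges x S x) (λ ω′ → none ω′ x S) (λ ω′ → chain ω′ x S x) (^-nonNeg x 0≤ρ)
        (λ ω ω′ agree → none-cong (λ v → agree (x , v) (λ e∈ → ℕ.<-irrefl refl (proj₁ (∈-chainEdges⁻ x e∈)))) S)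
        (λ ω₁ → ≤-trans (Pr-none x uS ω₁) small-S) (Pr-chain x uS x∉S (≤-trans small-S small))) ω
      where
      small-S : p̄ ^ length S ≤ δ
      small-S = ^-antimonoʳ-≤ 0≤p̄ p̄≤1 q≤S
      sub : ∀ {e} → e ∈ map (x ,_) S ++ chainEdges x S x → e ∈ es
      sub e∈ with ∈-++⁻ (map (x ,_) S) e∈
      ... | inj₁ e∈S with u , u∈ , refl ← ∈-map⁻ (x ,_) e∈S with u≥ , u< ← ∈U⁻ (S⊆U u∈) =
        covers x<s (ℕ.<-≤-trans x<s (ℕ.≤-trans (ℕ.m≤m+n s s) (ℕ.≤-trans 2s≤h u≥))) (ℕ.<-≤-trans u< h+s≤n)
      ... | inj₂ e∈chain with ∈-chainEdges⁻ x e∈chain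
      ...   | i<x , inj₁ refl = covers (ℕ.<-trans i<x x<s) i<x x<n
      ...   | i<x , inj₂ v∈ with u≥ , u< ← ∈U⁻ (S⊆U v∈) =
        covers (ℕ.<-trans i<x x<s) (ℕ.<-≤-trans (ℕ.<-trans i<x x<s) (ℕ.≤-trans (ℕ.m≤m+n s s) (ℕ.≤-trans 2s≤h u≥))) (ℕ.<-≤-trans u< h+s≤n)
    Pr-fail {es} covers {x} x<n {S} uS x∉S S⊆U q≤S ω | no x≮s rewrite dec-false (x ℕ.<? s) x≮s = E-≤-given (chainEdges x S s)
      (λ eq → cong ind (chain-cong x S s eq)) (All.tabulate sub)
      (Pr-chain s uS x∉S (≤-trans (^-antimonoʳ-≤ 0≤p̄ p̄≤1 q≤S) small)) ω
      where
      sub : ∀ {e} → e ∈ chainEdges x S s → e ∈ es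
      sub e∈ with ∈-chainEdges⁻ s e∈
      ... | i<s , inj₁ refl = covers i<s (ℕ.<-≤-trans i<s (ℕ.≮⇒≥ x≮s)) x<n
      ... | i<s , inj₂ v∈ with u≥ , u< ← ∈U⁻ (S⊆U v∈) =
        covers i<s (ℕ.<-≤-trans i<s (ℕ.≤-trans (ℕ.m≤m+n s s) (ℕ.≤-trans 2s≤h u≥))) (ℕ.<-≤-trans u< h+s≤n)

    -- Dropping `x` costs at most one element of `S`, hence the strict inequality on its length.
    Pr-fail-remove : ∀ {es} → Covers es → ∀ {x} → x ℕ.< n → ∀ {S} → Unique S → (∀ {u} → u ∈ S → u ∈ U) → q ℕ.< length S →
                     ∀ ω → Pr es (λ ω′ → fail ω′ x (remove x S)) ω ≤ cost x
    Pr-fail-remove covers {x} x<n {S} uS S⊆U q<S = Pr-fail covers x<n (filter⁺ _ uS)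
      (λ x∈ → proj₂ (∈-filter⁻ (λ u → ¬? (u ℕ.≟ x)) {xs = S} x∈) refl)
      (λ u∈ → S⊆U (proj₁ (∈-filter⁻ (λ u → ¬? (u ℕ.≟ x)) {xs = S} u∈)))
      (ℕ.s≤s⁻¹ (ℕ.≤-trans q<S (length-remove x uS)))

    bottomEdges : List Edge → List Edge
    bottomEdges = filter (λ e → proj₁ e ℕ.<? s)

    -- The hub and its targets are read off bits outside the bottom rows, so they are constants once those bits are fixed.
    Pr-failVia : ∀ {es} → Covers es → ∀ {x} j → x ℕ.< n → ∀ ω → Pr es (λ ω′ → failVia (inner ω′) ω′ x j) ω ≤ cost x
    Pr-failVia {es} covers {x} j x<n = E-≤-given (bottomEdges es)
      (λ eq → cong ind (failVia-cong x j (λ t v → eq (s ℕ.+ t , v)) eq))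
      (All.tabulate (λ e∈ → proj₁ (∈-filter⁻ (λ e → proj₁ e ℕ.<? s) {xs = es} e∈)))
      (λ ω → ≤-trans (≤-reflexive (E-cong-agree (bottomEdges es) ω (λ ω′ agree → cong ind
        (failVia-cong x j (λ t v → sym (agree (s ℕ.+ t , v) (above t v))) (λ _ → refl)))))
        (frozen (inner ω) ω))
      where
      above : ∀ t v → (s ℕ.+ t , v) ∉ bottomEdges es
      above t v e∈ = ℕ.<⇒≱ (proj₂ (∈-filter⁻ (λ e → proj₁ e ℕ.<? s) {xs = es} e∈)) (ℕ.m≤m+n s t)
      frozen : ∀ g ω → Pr (bottomEdges es) (λ ω′ → failVia g ω′ x j) ω ≤ cost x
      frozen g ω with findᵇ (λ t → g t (rev j)) (upTo s)
      ... | nothing = ≤-trans (≤-reflexive (E-const (bottomEdges es) 0ℚ ω)) (0≤cost x)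
      ... | just t with q ℕ.<? length (targets g t)
      ...   | no q≮ rewrite dec-false (q ℕ.<? length (targets g t)) q≮ =
        ≤-trans (≤-reflexive (E-const (bottomEdges es) 0ℚ ω)) (0≤cost x)
      ...   | yes q< rewrite dec-true (q ℕ.<? length (targets g t)) q< =
        Pr-fail-remove (λ i<s i<j j<n → ∈-filter⁺ (λ e → proj₁ e ℕ.<? s) (covers i<s i<j j<n) i<s) x<n
          (filter⁺ _ U-unique) (λ u∈ → proj₁ (∈-filter⁻ (λ u → g t u Bool.≟ false) {xs = U} u∈)) q< ω

    Pr-scarce : ∀ {es} → (∀ {i j} → i ℕ.< j → j ℕ.< n → (i , j) ∈ es) → ∀ {t} → t ℕ.< s → ∀ ω → Pr es (λ ω′ → scarce ω′ t) ω ≤ θ q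
    Pr-scarce {es} full {t} t<s = E-≤-given (map (s ℕ.+ t ,_) U)
      (λ eq → cong ind (scarce-cong t eq)) (All.tabulate sub)
      (λ ω → ≤-trans (Pr-few (s ℕ.+ t) q U-unique ω)
        (≤-trans (≤-reflexive (cong (λ k → ι 4 ^ q * (+ 5 / 8) ^ k) (trans length-U s≡8q))) (4^n*⅝^8n≤θ q)))
      where
      sub : ∀ {e} → e ∈ map (s ℕ.+ t ,_) U → e ∈ es
      sub e∈ with u , u∈ , refl ← ∈-map⁻ (s ℕ.+ t ,_) e∈ with u≥ , u< ← ∈U⁻ u∈ =
        full (ℕ.<-≤-trans (ℕ.+-monoʳ-< s t<s) (ℕ.≤-trans 2s≤h u≥)) (ℕ.<-≤-trans u< h+s≤n)

    -- There are one plus min(x+1, s) events, each of probability at most `cost x`. For `x` in A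
    -- their number is bounded by x+2, which gives the first summand; otherwise it is bounded by
    -- s+1, which gives the second.
    Pr-stuck : ∀ {es} → Covers es → q ℕ.< s → ∀ {x} → x ℕ.< n → ∀ ω →
               Pr es (λ ω′ → stuck ω′ x) ω ≤ ι (2 ℕ.+ x) * (δ * ρ ^ x) + ι (suc s) * θ q
    Pr-stuck {es} covers q<s {x} x<n ω = begin
      Pr es (λ ω′ → stuck ω′ x) ω
        ≤⟨ Pr-∨ es (λ ω′ → fail ω′ x (remove x U)) (λ ω′ → anyBelow m (failVia (inner ω′) ω′ x)) ω ⟩
      Pr es (λ ω′ → fail ω′ x (remove x U)) ω + Pr es (λ ω′ → anyBelow m (failVia (inner ω′) ω′ x)) ω
        ≤⟨ +-mono-≤ (Pr-fail-remove covers x<n U-unique (λ u∈ → u∈) (subst (q ℕ.<_) (sym length-U) q<s) ω)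
             (Pr-anyBelow es m (λ j ω′ → failVia (inner ω′) ω′ x j) {λ _ → cost x} ω (λ {j} _ → Pr-failVia covers j x<n ω)) ⟩
      cost x + sumBelow m (λ _ → cost x)
        ≡⟨ sumBelow-const (suc m) (cost x) ⟩
      ι (suc m) * cost x
        ≤⟨ split ⟩
      ι (2 ℕ.+ x) * (δ * ρ ^ x) + ι (suc s) * θ q ∎
      where
      open ≤-Reasoning
      m = suc x ℕ.⊓ s
      split : ι (suc m) * cost x ≤ ι (2 ℕ.+ x) * (δ * ρ ^ x) + ι (suc s) * θ q
      split with does (x ℕ.<? s)
      ... | true  = ≤-+ (*-monoʳ (0≤* 0≤δ (^-nonNeg x 0≤ρ)) (ι-mono (ℕ.s≤s (ℕ.m⊓n≤m (suc x) s)))) (0≤* (0≤ι (suc s)) (0≤θ q))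
        where
        ≤-+ : ∀ {a b c} → a ≤ b → 0ℚ ≤ c → a ≤ b + c
        ≤-+ a≤b 0≤c = ≤-trans a≤b (≤-byDiff refl 0≤c)
      ... | false = begin
        ι (suc m) * ρ ^ s     ≤⟨ *-mono (0≤ι (suc s)) (^-nonNeg s 0≤ρ) (ι-mono (ℕ.s≤s (ℕ.m⊓n≤n (suc x) s)))
                                   (≤-trans (≤-reflexive (cong (ρ ^_) s≡8q)) (ρ^8n≤θ q)) ⟩
        ι (suc s) * θ q       ≤⟨ ≤-byDiff (lemma (ι (2 ℕ.+ x) * (δ * ρ ^ x)) (ι (suc s) * θ q)) (0≤* (0≤ι (2 ℕ.+ x)) (0≤* 0≤δ (^-nonNeg x 0≤ρ))) ⟩
        ι (2 ℕ.+ x) * (δ * ρ ^ x) + ι (suc s) * θ q ∎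
        where
        lemma : ∀ a b → a + b ≡ b + a
        lemma = solve-∀ ℚ-ring

    Pr-bad : ∀ {es} → (∀ {i j} → i ℕ.< j → j ℕ.< n → (i , j) ∈ es) → q ℕ.< s → ∀ ω →
             Pr es bad ω ≤ ι 20 * δ + ι n * (ι (suc s) * θ q) + ι s * θ q
    Pr-bad {es} full q<s ω = begin
      Pr es bad ω
        ≤⟨ Pr-∨ es (λ ω′ → anyBelow n (stuck ω′)) (λ ω′ → anyBelow s (scarce ω′)) ω ⟩
      Pr es (λ ω′ → anyBelow n (stuck ω′)) ω + Pr es (λ ω′ → anyBelow s (scarce ω′)) ω
        ≤⟨ +-mono-≤ (Pr-anyBelow es n (λ x ω′ → stuck ω′ x) ω (λ x<n → Pr-stuck (λ _ → full) q<s x<n ω))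
             (Pr-anyBelow es s (λ t ω′ → scarce ω′ t) ω (λ t<s → Pr-scarce full t<s ω)) ⟩
      sumBelow n (λ x → ι (2 ℕ.+ x) * (δ * ρ ^ x) + ι (suc s) * θ q) + sumBelow s (λ _ → θ q)
        ≡⟨ cong₂ _+_ (trans (sumBelow-+ n (λ x → ι (2 ℕ.+ x) * (δ * ρ ^ x)) (λ _ → ι (suc s) * θ q))
             (cong (_+_ (sumBelow n (λ x → ι (2 ℕ.+ x) * (δ * ρ ^ x)))) (sumBelow-const n (ι (suc s) * θ q)))) (sumBelow-const s (θ q)) ⟩
      sumBelow n (λ x → ι (2 ℕ.+ x) * (δ * ρ ^ x)) + ι n * (ι (suc s) * θ q) + ι s * θ q
        ≤⟨ +-monoˡ-≤ (ι s * θ q) (+-monoˡ-≤ (ι n * (ι (suc s) * θ q)) (arithGeom-≤ n 0≤δ)) ⟩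
      ι 20 * δ + ι n * (ι (suc s) * θ q) + ι s * θ q ∎
      where open ≤-Reasoning

-- Assembling the paths

walk-++ : ∀ {n} {T : Tournament n} {m k x y z} → Walk T m x y → Walk T k y z → Walk T (m ℕ.+ k) x z
walk-++ nil           w = w
walk-++ (step x≻y w′) w = step x≻y (walk-++ w′ w)

module Reflection (n : ℕ) where

  -- Numbers from `n` on are left fixed, which makes this an involution on all of `ℕ`.
  reflect : ℕ → ℕ
  reflect i = if does (i ℕ.<? n) then n ℕ.∸ suc i else i

  reflect-< : ∀ {i} → i ℕ.< n → reflect i ≡ n ℕ.∸ suc i
  reflect-< {i} i<n rewrite dec-true (i ℕ.<? n) i<n = refl

  reflect-≮ : ∀ {i} → i ℕ.≮ n → reflect i ≡ i
  reflect-≮ {i} i≮n rewrite dec-false (i ℕ.<? n) i≮n = refl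

  ∸suc-< : ∀ {i} → i ℕ.< n → n ℕ.∸ suc i ℕ.< n
  ∸suc-< {i} i<n = ℕ.∸-monoʳ-< {n} {suc i} {0} (ℕ.s≤s ℕ.z≤n) i<n

  reflect-involutive : ∀ i → reflect (reflect i) ≡ i
  reflect-involutive i with i ℕ.<? n
  ... | no i≮n  = trans (cong reflect (reflect-≮ i≮n)) (reflect-≮ i≮n)
  ... | yes i<n = begin
    reflect (reflect i)              ≡⟨ cong reflect (reflect-< i<n) ⟩
    reflect (n ℕ.∸ suc i)            ≡⟨ reflect-< (∸suc-< i<n) ⟩
    n ℕ.∸ suc (n ℕ.∸ suc i)          ≡⟨ cong (n ℕ.∸_) (ℕ.+-∸-assoc 1 i<n) ⟨
    n ℕ.∸ (n ℕ.∸ i)                  ≡⟨ ℕ.m∸[m∸n]≡n (ℕ.<⇒≤ i<n) ⟩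
    i                                ∎
    where open ≡-Reasoning

  -- The endpoints are exchanged to keep the smaller position first. Since the order and all edges
  -- are reversed together, `true` still marks an upset.
  φ : Edge → Edge
  φ (i , j) = reflect j , reflect i

  φ-involutive : ∀ e → φ (φ e) ≡ e
  φ-involutive (i , j) = cong₂ _,_ (reflect-involutive i) (reflect-involutive j)

module Combine (q s n h : ℕ) (2s≤h : s ℕ.+ s ℕ.≤ h) (n≡ : h ℕ.+ (s ℕ.+ s) ≡ n) (ω : Ω) where

  open Events q s n h
  open Reflection n

  ω* : Ω
  ω* = ω ∘ φ

  h+s≤n : h ℕ.+ s ℕ.≤ n
  h+s≤n = ℕ.≤-trans (ℕ.+-monoʳ-≤ h (ℕ.m≤m+n s s)) (ℕ.≤-reflexive n≡)

  2s≤n : s ℕ.+ s ℕ.≤ n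
  2s≤n = ℕ.≤-trans (ℕ.m≤n+m (s ℕ.+ s) h) (ℕ.≤-reflexive n≡)

  s≤n : s ℕ.≤ n
  s≤n = ℕ.≤-trans (ℕ.m≤m+n s s) 2s≤n

  -- Order reversal carries the interval from `a` to `b` to the one from `c` to `d`; it is applied
  -- to exchange U with W and to carry A to B.
  reflect-between : ∀ {a b c d i} → a ℕ.+ d ≡ n → b ℕ.+ c ≡ n → a ℕ.≤ i → i ℕ.< b → c ℕ.≤ reflect i × reflect i ℕ.< d
  reflect-between {a} {b} {c} {d} {i} a+d≡n b+c≡n a≤i i<b rewrite reflect-< {i} (ℕ.<-≤-trans i<b (ℕ.m+n≤o⇒m≤o b (ℕ.≤-reflexive b+c≡n))) =
    (begin
      c                    ≡⟨ ℕ.m+n∸m≡n b c ⟨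
      b ℕ.+ c ℕ.∸ b        ≡⟨ cong (ℕ._∸ b) b+c≡n ⟩
      n ℕ.∸ b              ≤⟨ ℕ.∸-monoʳ-≤ n i<b ⟩
      n ℕ.∸ suc i          ∎) ,
    (begin-strict
      n ℕ.∸ suc i          <⟨ ℕ.∸-monoʳ-< (ℕ.n<1+n i) (ℕ.<-≤-trans i<b (ℕ.m+n≤o⇒m≤o b (ℕ.≤-reflexive b+c≡n))) ⟩
      n ℕ.∸ i              ≤⟨ ℕ.∸-monoʳ-≤ n a≤i ⟩
      n ℕ.∸ a              ≡⟨ cong (ℕ._∸ a) a+d≡n ⟨
      a ℕ.+ d ℕ.∸ a        ≡⟨ ℕ.m+n∸m≡n a d ⟩
      d                    ∎)
    where open ℕ.≤-Reasoning

  UtoW : ∀ {u} → h ℕ.≤ u → u ℕ.< h ℕ.+ s → s ℕ.≤ reflect u × reflect u ℕ.< s ℕ.+ s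
  UtoW = reflect-between n≡ (trans (ℕ.+-assoc h s s) n≡)

  WtoU : ∀ {w} → s ℕ.≤ w → w ℕ.< s ℕ.+ s → h ℕ.≤ reflect w × reflect w ℕ.< h ℕ.+ s
  WtoU = reflect-between
    (trans (sym (ℕ.+-assoc s h s)) (trans (cong (ℕ._+ s) (ℕ.+-comm s h)) (trans (ℕ.+-assoc h s s) n≡)))
    (trans (ℕ.+-comm (s ℕ.+ s) h) n≡)

  reflect<n : ∀ {i} → i ℕ.< n → reflect i ℕ.< n
  reflect<n i<n = subst (ℕ._< n) (sym (reflect-< i<n)) (∸suc-< i<n)

  reflect-anti : ∀ {i j} → i ℕ.< j → j ℕ.< n → reflect j ℕ.< reflect i
  reflect-anti i<j j<n rewrite reflect-< j<n | reflect-< (ℕ.<-trans i<j j<n) = ℕ.∸-monoʳ-< (ℕ.s≤s i<j) j<n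

  T : Tournament n
  T = toTournament ω 0 n

  upset : ∀ {i j : Fin n} {a b} → toℕ i ≡ a → toℕ j ≡ b → a ℕ.< b → ω (a , b) ≡ true → _≻_ T i j
  upset {i} {j} refl refl a<b eq = trans (dom-< ω 0 i j a<b) eq

  forward : ∀ {i j : Fin n} {a b} → toℕ i ≡ a → toℕ j ≡ b → b ℕ.< a → ω (b , a) ≡ false → _≻_ T i j
  forward {i} {j} refl refl b<a eq = trans (dom-> ω 0 i j b<a) (cong not eq)

  -- Here `y` is the reflected position of the goal. In terms of `ω`, `to-y` says that `reflect j`,
  -- a member of B, is the goal or beats it.
  record Path (x y : ℕ) : Set where
    field
      {a u w j} : ℕ
      from-x  : Reach ω x a
      to-y    : Reach ω* y j
      u≥      : h ℕ.≤ u
      u<      : u ℕ.< h ℕ.+ s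
      w≥      : s ℕ.≤ w
      w<      : w ℕ.< s ℕ.+ s
      a-u     : ω (a , u) ≡ true
      u-w     : ω (w , u) ≡ false
      w-b     : ω (w , reflect j) ≡ true

  path⇒walk : ∀ (x y : Fin n) → Path (toℕ x) (reflect (toℕ y)) → ∃[ m ] m ℕ.≤ 5 × Walk T m x y
  path⇒walk x y π = let m₁ , m₁≤1 , walk₁ = first-leg (proj₂ from-x) ; m₂ , m₂≤1 , walk₂ = last-leg (proj₂ to-y) in
    -- Three middle edges are always present, and the legs at the two ends have at most one edge
    -- each.
    m₁ ℕ.+ suc (suc (suc m₂)) , ℕ.+-mono-≤ m₁≤1 (ℕ.s≤s (ℕ.s≤s (ℕ.s≤s m₂≤1))) ,
    walk-++ walk₁ (step (upset toA toU a<u a-u) (step (forward toU toW w<u u-w) (step (upset toW toB w<b w-b) walk₂)))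
    where
    open Path π
    j<n : j ℕ.< n
    j<n = ℕ.<-≤-trans (proj₁ to-y) s≤n
    w<u : w ℕ.< u
    w<u = ℕ.<-≤-trans w< (ℕ.≤-trans 2s≤h u≥)
    a<u : a ℕ.< u
    a<u = ℕ.<-≤-trans (proj₁ from-x) (ℕ.≤-trans w≥ (ℕ.<⇒≤ w<u))
    w<b : w ℕ.< reflect j
    w<b = ℕ.<-≤-trans w< (ℕ.≤-trans 2s≤h (ℕ.≤-trans (ℕ.m≤m+n h s)
      (proj₁ (reflect-between {0} {s} refl (trans (ℕ.+-comm s (h ℕ.+ s)) (trans (ℕ.+-assoc h s s) n≡)) ℕ.z≤n (proj₁ to-y)))))
    vertex : ∀ {i} → i ℕ.< n → ∃[ v ] toℕ v ≡ i
    vertex i<n = fromℕ< i<n , toℕ-fromℕ< i<n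
    toA = proj₂ (vertex (ℕ.<-≤-trans (proj₁ from-x) s≤n))
    toU = proj₂ (vertex (ℕ.<-≤-trans u< h+s≤n))
    toW = proj₂ (vertex (ℕ.<-≤-trans w< 2s≤n))
    toB = proj₂ (vertex (reflect<n j<n))
    first-leg : a ≡ toℕ x ⊎ (a ℕ.< toℕ x × ω (a , toℕ x) ≡ false) →
                ∃[ m ] m ℕ.≤ 1 × Walk T m x (fromℕ< (ℕ.<-≤-trans (proj₁ from-x) s≤n))
    first-leg (inj₁ a≡x) = 0 , ℕ.z≤n , subst (Walk T 0 x) (toℕ-injective (trans (sym a≡x) (sym toA))) nil
    first-leg (inj₂ (a<x , x-a)) = 1 , ℕ.≤-refl , step (forward refl toA a<x x-a) nil
    last-leg : j ≡ reflect (toℕ y) ⊎ (j ℕ.< reflect (toℕ y) × ω* (j , reflect (toℕ y)) ≡ false) →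
               ∃[ m ] m ℕ.≤ 1 × Walk T m (fromℕ< (reflect<n j<n)) y
    last-leg (inj₁ j≡) = 0 , ℕ.z≤n , subst (λ v → Walk T 0 v y)
      (toℕ-injective (trans (sym (reflect-involutive (toℕ y))) (trans (cong reflect (sym j≡)) (sym toB)))) nil
    last-leg (inj₂ (j<y , b-y)) = 1 , ℕ.≤-refl , step (forward toB refl
      (subst (ℕ._< reflect j) (reflect-involutive (toℕ y)) (reflect-anti j<y (reflect<n (toℕ<n y))))
      (subst (λ i → ω (i , reflect j) ≡ false) (reflect-involutive (toℕ y)) b-y)) nil

  -- Both ends first get candidates: `a` for `x`, and `j` for the reflected `y`. If `j ≤ x`, then b
  -- = `rev j` is kept and `x` is linked to it. Otherwise a ≤ x < j ≤ reflected y, so the roles can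
  -- be exchanged by reversal.
  allKings : bad ω ≡ false → bad ω* ≡ false → AllKings 5 T
  allKings ok ok* x y _ = path⇒walk x y path
    where
    x<n : toℕ x ℕ.< n
    x<n = toℕ<n x
    y<n : reflect (toℕ y) ℕ.< n
    y<n = reflect<n (toℕ<n y)
    Reach⇒≤ : ∀ {ω x i} → Reach ω x i → i ℕ.≤ x
    Reach⇒≤ (_ , inj₁ refl)      = ℕ.≤-refl
    Reach⇒≤ (_ , inj₂ (i<x , _)) = ℕ.<⇒≤ i<x
    path : Path (toℕ x) (reflect (toℕ y))
    path with a , ra , u , u≥ , u< , a-u ← good-reach ok x<n
         with j , rj , u* , u*≥ , u*< , j-u* ← good-reach ok* y<n
         with j ℕ.≤? toℕ x
    -- The upset from `j` to `u*` in `ω*` reads in `ω` as an upset from the member `reflect u*` of W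
    -- over `rev j`, so the search for a hub has a witness.
    ... | yes j≤x = record
      { from-x = reach ; to-y = rj ; u≥ = Linked.u≥ link ; u< = Linked.u< link ; w≥ = w≥ ; w< = w<
      ; a-u = Linked.a-u link ; u-w = u-w ; w-b = subst (λ b → ω (w , b) ≡ true) (sym (reflect-< j<n)) w-b }
      where
      j<n : j ℕ.< n
      j<n = ℕ.<-≤-trans (proj₁ rj) s≤n
      s≤w₀ = proj₁ (UtoW u*≥ u*<)
      link : Linked ω (toℕ x) j
      link = good-linked ok x<n (proj₁ rj) j≤x
        (ℕ.+-cancelˡ-< s _ _ (subst (ℕ._< s ℕ.+ s) (sym (ℕ.m+[n∸m]≡n s≤w₀)) (proj₂ (UtoW u*≥ u*<))))
        (subst₂ (λ w b → ω (w , b) ≡ true) (sym (ℕ.m+[n∸m]≡n s≤w₀)) (reflect-< j<n) j-u*)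
      open Linked link using (w; reach; w≥; w<; u-w; w-b)
    -- The link found in `ω*` is read backwards: its `w` becomes the member of U, its `u` becomes
    -- the member of W, and its `a` gives the end in B.
    ... | no j≰x = record
      { from-x = ra ; to-y = reach
      ; u≥ = proj₁ (WtoU w≥ w<) ; u< = proj₂ (WtoU w≥ w<) ; w≥ = proj₁ (UtoW (Linked.u≥ link) (Linked.u< link)) ; w< = proj₂ (UtoW (Linked.u≥ link) (Linked.u< link))
      ; a-u = subst (λ i → ω (i , reflect w) ≡ true) (trans (cong reflect (sym (reflect-< a<n))) (reflect-involutive a)) w-b
      ; u-w = u-w
      ; w-b = Linked.a-u link }
      where
      a<n : a ℕ.< n
      a<n = ℕ.<-≤-trans (proj₁ ra) s≤n
      s≤w₀ = proj₁ (UtoW u≥ u<)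
      link : Linked ω* (reflect (toℕ y)) a
      link = good-linked ok* y<n (proj₁ ra) (ℕ.≤-trans (Reach⇒≤ {ω} ra) (ℕ.≤-trans (ℕ.<⇒≤ (ℕ.≰⇒> j≰x)) (Reach⇒≤ {ω*} rj)))
        (ℕ.+-cancelˡ-< s _ _ (subst (ℕ._< s ℕ.+ s) (sym (ℕ.m+[n∸m]≡n s≤w₀)) (proj₂ (UtoW u≥ u<))))
        (trans (cong ω (cong₂ _,_ (trans (cong reflect (sym (reflect-< a<n))) (reflect-involutive a))
          (trans (cong reflect (ℕ.m+[n∸m]≡n s≤w₀)) (reflect-involutive u)))) a-u)
      open Linked link using (w; reach; w≥; w<; u-w; w-b)

-- Success probability for fixed n and the limit

sideBound : ℚ → ℕ → ℕ → ℚ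
sideBound p q n = ι 20 * (1ℚ - p) ^ q + ι n * (ι (suc (8 ℕ.* q)) * θ q) + ι (8 ℕ.* q) * θ q

-- In every outcome all alternatives are 5-kings, or `bad` holds, or `bad` holds after reversal. By
-- reindexing, the reversed event obeys the same bound.
Prob-allKings : ∀ {p} q n → 0ℚ ≤ p → p ≤ ½ → (1ℚ - p) ^ q ≤ ½ → 0 ℕ.< q → q ℕ.* 32 ℕ.≤ n → (dec : Decidable (AllKings 5 {n})) →
                1ℚ ≤ Prob n p (AllKings 5) dec + (sideBound p q n + sideBound p q n)
Prob-allKings {p} q n 0≤p p≤½ small 0<q 32q≤n dec = begin
  1ℚ
    ≡⟨ E-const es 1ℚ ω₀ ⟨
  E es (λ _ → 1ℚ) ω₀
    ≤⟨ E-mono es ω₀ cover ⟩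
  E es (λ ω → ind (does (dec (toTournament ω 0 n))) + (ind (bad ω) + ind (bad (ω ∘ φ)))) ω₀
    ≡⟨ trans (E-+ es win (λ ω → ind (bad ω) + ind (bad (ω ∘ φ))) ω₀)
         (cong (_+_ (E es win ω₀)) (E-+ es (λ ω → ind (bad ω)) (λ ω → ind (bad (ω ∘ φ))) ω₀)) ⟩
  Pr es (λ ω → does (dec (toTournament ω 0 n))) ω₀ + (Pr es bad ω₀ + Pr es (λ ω → bad (ω ∘ φ)) ω₀)
    ≡⟨ cong₂ (λ a b → a + (Pr es bad ω₀ + b)) (sym (Prob-≡-Pr n (AllKings 5) dec ω₀)) (E-reindex es {λ ω → ind (bad ω)} (λ eq → cong ind (bad-cong eq)) ω₀) ⟩
  Prob n p (AllKings 5) dec + (Pr es bad ω₀ + Pr (map φ es) bad (ω₀ ∘ φ))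
    ≤⟨ +-monoʳ-≤ (Prob n p (AllKings 5) dec) (+-mono-≤ (Pr-bad (∈-allEdges ℕ.z≤n) q<s ω₀) (Pr-bad full* q<s (ω₀ ∘ φ))) ⟩
  Prob n p (AllKings 5) dec + (sideBound p q n + sideBound p q n) ∎
  where
  open ≤-Reasoning
  s = 8 ℕ.* q
  -- U starts here, just below B. The four blocks of size 8q are disjoint because 32q ≤ n.
  h = n ℕ.∸ (s ℕ.+ s)
  es = allEdges 0 n
  ω₀ : Ω
  ω₀ _ = false
  win : Ω → ℚ
  win ω = ind (does (dec (toTournament ω 0 n)))
  4s≤n : s ℕ.+ s ℕ.+ (s ℕ.+ s) ℕ.≤ n
  4s≤n = ℕ.≤-trans (ℕ.≤-reflexive (lemma q)) 32q≤n
    where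
    lemma : ∀ q → 8 ℕ.* q ℕ.+ 8 ℕ.* q ℕ.+ (8 ℕ.* q ℕ.+ 8 ℕ.* q) ≡ q ℕ.* 32
    lemma = ℕ-Solver.solve-∀
  n≡ : h ℕ.+ (s ℕ.+ s) ≡ n
  n≡ = ℕ.m∸n+n≡m (ℕ.m+n≤o⇒m≤o (s ℕ.+ s) 4s≤n)
  2s≤h : s ℕ.+ s ℕ.≤ h
  2s≤h = ℕ.m+n≤o⇒m≤o∸n (s ℕ.+ s) 4s≤n
  q<s : q ℕ.< s
  q<s = ℕ.m<m+n q (ℕ.<-≤-trans 0<q (ℕ.m≤m+n q (6 ℕ.* q)))
  open Bounds p 0≤p p≤½ using (p≤1; module OneSided)
  open Expectation p 0≤p p≤1
  open Model p 0≤p p≤1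
  open Events q s n h using (bad; bad-cong)
  open Reflection n
  open Reindex φ φ-involutive
  open OneSided q s n h refl 2s≤h (ℕ.≤-trans (ℕ.+-monoʳ-≤ h (ℕ.m≤m+n s s)) (ℕ.≤-reflexive n≡)) small using (Pr-bad)
  full* : ∀ {i j} → i ℕ.< j → j ℕ.< n → (i , j) ∈ map φ es
  full* {i} {j} i<j j<n = subst (_∈ map φ es) (φ-involutive (i , j))
    (∈-map⁺ φ (∈-allEdges ℕ.z≤n (reflect-anti i<j j<n) (reflect<n (ℕ.<-trans i<j j<n))))
    where open Combine q s n h 2s≤h n≡ ω₀
  cover : ∀ ω → 1ℚ ≤ ind (does (dec (toTournament ω 0 n))) + (ind (bad ω) + ind (bad (ω ∘ φ)))
  cover ω with bad ω in ok | bad (ω ∘ φ) in ok*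
  ... | true  | b    = ≤-byDiff (lemma (win ω) (ind b)) (0≤+ (0≤ind (does (dec (toTournament ω 0 n)))) (0≤ind b))
    where
    lemma : ∀ x y → x + (1ℚ + y) ≡ 1ℚ + (x + y)
    lemma = solve-∀ ℚ-ring
  ... | false | true = ≤-byDiff (comm (ind (does (dec (toTournament ω 0 n))))) (0≤ind (does (dec (toTournament ω 0 n))))
    where
    comm : ∀ x → x + (0ℚ + 1ℚ) ≡ 1ℚ + x
    comm = solve-∀ ℚ-ring
  ... | false | false = ≤-reflexive (sym (cong (λ b → ind b + (0ℚ + 0ℚ)) (dec-true (dec _) (Combine.allKings q s n h 2s≤h n≡ ω ok ok*))))

theorem3 : (p : ℕ → ℚ)
    → (∀ n → 0ℚ ≤ p n × p n ≤ ½)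
    → (∀ (M : ℚ) → ∃[ N ] ∀ n → N ℕ.≤ n → M ≤ (+ n / 1) * p n)
    → (dec : ∀ n → Decidable (AllKings 5 {n}))
    → ∀ (ε : ℚ) → 0ℚ < ε
    → ∃[ N ] ∀ n → N ℕ.≤ n → 1ℚ - ε ≤ Prob n (p n) (AllKings 5 {n}) (dec n)
theorem3 p bounds np→∞ dec ε 0<ε with archimedean ε 0<ε
... | zero , 1≤0 = contradiction (≤-trans 1≤0 (≤-reflexive (*-zeroˡ ε))) (λ { (*≤* (ℤ.+≤+ ())) })
-- Twice the one-sided bound is at most 40δ + 528T with T = (q+1)²8^(-q). Half of ε for each term
-- asks for 80δ ≤ ε and 1056T ≤ ε. The factor 32 in 2560 = 32·80 and in the threshold on n converts
-- between n and q.
... | K@(suc _) , 1≤Kε = let N , Np = np→∞ (ι (2560 ℕ.* K)) in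
  N ℕ.⊔ 1056 ℕ.* K ℕ.* 32 , λ n N′≤n → bound n (ℕ.m⊔n≤o⇒n≤o N _ N′≤n) (Np n (ℕ.m⊔n≤o⇒m≤o N _ N′≤n))
  where
  open ≤-Reasoning
  0≤ε : 0ℚ ≤ ε
  0≤ε = <⇒≤ 0<ε
  bound : ∀ n → 1056 ℕ.* K ℕ.* 32 ℕ.≤ n → ι (2560 ℕ.* K) ≤ ι n * p n → 1ℚ - ε ≤ Prob n (p n) (AllKings 5 {n}) (dec n)
  bound n large np = final
    where
    pₙ = p n
    0≤p = proj₁ (bounds n)
    p≤½ = proj₂ (bounds n)
    p≤1 : pₙ ≤ 1ℚ
    p≤1 = ≤-trans p≤½ (≤ᵇ⇒≤ _)
    q = n ℕ./ 32
    Q = ι (suc q)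
    T = Q * (Q * θ q)
    δ = (1ℚ - pₙ) ^ q
    0≤δ : 0ℚ ≤ δ
    0≤δ = ^-nonNeg q (0≤- p≤1)
    0≤Q : 0ℚ ≤ Q
    0≤Q = 0≤ι (suc q)
    0≤T : 0ℚ ≤ T
    0≤T = 0≤* 0≤Q (0≤* 0≤Q (0≤θ q))
    1056K≤q : 1056 ℕ.* K ℕ.≤ q
    1056K≤q = ℕ.≤-trans (ℕ.≤-reflexive (sym (m*n/n≡m (1056 ℕ.* K) 32))) (/-monoˡ-≤ 32 large)
    n≤32Q : ι n ≤ ι 32 * Q
    n≤32Q = ≤-trans (ι-mono n≤) (≤-reflexive (ι-* 32 (suc q)))
      where
      n≤ : n ℕ.≤ 32 ℕ.* suc q
      n≤ = ℕ.≤-trans (ℕ.≤-reflexive (m≡m%n+[m/n]*n n 32))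
        (ℕ.≤-trans (ℕ.+-monoˡ-≤ (q ℕ.* 32) (ℕ.<⇒≤ (m%n<n n 32))) (ℕ.≤-reflexive (ℕ.*-comm (suc q) 32)))
    80Kδ≤1 : ι 80 * ι K * δ ≤ 1ℚ
    80Kδ≤1 = begin
      ι 80 * ι K * δ                        ≤⟨ *-monoʳ 0≤δ 80K≤ ⟩
      (1ℚ + ι q * pₙ) * δ                   ≡⟨ *-comm _ δ ⟩
      δ * (1ℚ + ι q * pₙ)                   ≤⟨ bernoulli q 0≤p p≤1 ⟩
      1ℚ                                    ∎
      where
      32nd : ∀ x → x ≡ + 1 / 32 * (ι 32 * x)
      32nd = solve-∀ ℚ-ring
      scale : ∀ k → ι 80 * k ≡ + 1 / 32 * (ι 2560 * k)
      scale = solve-∀ ℚ-ring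
      -- The hypothesis yields (q+1)p ≥ 80K; the surplus `p` over qp is absorbed by the 1, as p ≤ 1.
      lemma : ∀ k p → 1ℚ + k * p ≡ + 1 / 32 * (ι 32 * (1ℚ + k) * p) + (1ℚ - p)
      lemma = solve-∀ ℚ-ring
      80K≤ : ι 80 * ι K ≤ 1ℚ + ι q * pₙ
      80K≤ = begin
        ι 80 * ι K                                ≡⟨ scale (ι K) ⟩
        + 1 / 32 * (ι 2560 * ι K)                 ≡⟨ cong (+ 1 / 32 *_) (ι-* 2560 K) ⟨
        + 1 / 32 * ι (2560 ℕ.* K)                 ≤⟨ *-monoˡ {+ 1 / 32} (≤ᵇ⇒≤ _) (≤-trans np (*-monoʳ 0≤p n≤32Q)) ⟩
        + 1 / 32 * (ι 32 * Q * pₙ)                ≡⟨ cong (λ k → + 1 / 32 * (ι 32 * k * pₙ)) (ι-suc q) ⟩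
        + 1 / 32 * (ι 32 * (1ℚ + ι q) * pₙ)       ≤⟨ ≤-byDiff (lemma (ι q) pₙ) (0≤- p≤1) ⟩
        1ℚ + ι q * pₙ                             ∎
    1≤K : 1ℚ ≤ ι K
    1≤K = ι-mono {1} {K} (ℕ.s≤s ℕ.z≤n)
    δ≤½ : δ ≤ ½
    δ≤½ = begin
      δ                            ≡⟨ lemma δ ⟩
      ½ * (ι 2 * 1ℚ * δ)           ≤⟨ *-monoˡ {½} (≤ᵇ⇒≤ _) (*-monoʳ 0≤δ (*-mono {ι 2} {ι 80} (0≤ι 80) 0≤1 (≤ᵇ⇒≤ _) 1≤K)) ⟩
      ½ * (ι 80 * ι K * δ)         ≤⟨ *-monoˡ {½} (≤ᵇ⇒≤ _) 80Kδ≤1 ⟩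
      ½ * 1ℚ                       ≡⟨⟩
      ½                            ∎
      where
      lemma : ∀ δ → δ ≡ ½ * (ι 2 * 1ℚ * δ)
      lemma = solve-∀ ℚ-ring
    -- Multiplication by `ι K * ε`, which is at least 1, replaces division by `K`.
    ≤ε : ∀ c x → 0ℚ ≤ c * x → c * ι K * x ≤ 1ℚ → c * x ≤ ε
    ≤ε c x 0≤cx cKx≤1 = begin
      c * x                  ≡⟨ *-identityʳ (c * x) ⟨
      c * x * 1ℚ             ≤⟨ *-monoˡ 0≤cx 1≤Kε ⟩
      c * x * (ι K * ε)      ≡⟨ lemma c x (ι K) ε ⟩
      c * ι K * x * ε        ≤⟨ *-monoʳ 0≤ε cKx≤1 ⟩
      1ℚ * ε                 ≡⟨ *-identityˡ ε ⟩
      ε                      ∎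
      where
      lemma : ∀ c x k ε → c * x * (k * ε) ≡ c * k * x * ε
      lemma = solve-∀ ℚ-ring
    80δ≤ε : ι 80 * δ ≤ ε
    80δ≤ε = ≤ε (ι 80) δ (0≤* (0≤ι 80) 0≤δ) 80Kδ≤1
    1056T≤ε : ι 1056 * T ≤ ε
    1056T≤ε = ≤ε (ι 1056) T (0≤* (0≤ι 1056) 0≤T) (begin
      ι 1056 * ι K * T           ≡⟨ cong (_* T) (ι-* 1056 K) ⟨
      ι (1056 ℕ.* K) * T         ≤⟨ *-monoʳ 0≤T (ι-mono (ℕ.m≤n⇒m≤1+n 1056K≤q)) ⟩
      Q * T                      ≤⟨ suc³*θ≤1 q ⟩
      1ℚ                         ∎)
    s = 8 ℕ.* q
    B = sideBound pₙ q n
    suc-s≤8Q : ι (suc s) ≤ ι 8 * Q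
    suc-s≤8Q = ≤-trans (ι-mono (ℕ.≤-trans (ℕ.+-monoˡ-≤ s (ℕ.s≤s (ℕ.z≤n {7}))) (ℕ.≤-reflexive (sym (ℕ.*-suc 8 q))))) (≤-reflexive (ι-* 8 (suc q)))
    -- Here 264 = 32·8 + 8: the first product comes from n ≤ 32Q and s+1 ≤ 8Q, and the last 8 from
    -- the scarce hubs.
    B≤ : B ≤ ι 20 * δ + ι 264 * T
    B≤ = begin
      ι 20 * δ + ι n * (ι (suc s) * θ q) + ι s * θ q
        ≤⟨ +-mono-≤ (+-monoʳ-≤ (ι 20 * δ) (*-mono (0≤* (0≤ι 32) 0≤Q) (0≤* (0≤ι (suc s)) (0≤θ q)) n≤32Q (*-monoʳ (0≤θ q) suc-s≤8Q)))
             (≤-trans (*-monoʳ (0≤θ q) (≤-trans (ι-mono (ℕ.n≤1+n s)) suc-s≤8Q)) 8Qθ≤8T) ⟩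
      ι 20 * δ + ι 32 * Q * (ι 8 * Q * θ q) + ι 8 * T
        ≡⟨ lemma δ Q (θ q) ⟩
      ι 20 * δ + ι 264 * T ∎
      where
      lemma : ∀ δ Q θ → ι 20 * δ + ι 32 * Q * (ι 8 * Q * θ) + ι 8 * (Q * (Q * θ)) ≡ ι 20 * δ + ι 264 * (Q * (Q * θ))
      lemma = solve-∀ ℚ-ring
      8Qθ≤8T : ι 8 * Q * θ q ≤ ι 8 * T
      8Qθ≤8T = begin
        ι 8 * Q * θ q             ≡⟨ *-assoc (ι 8) Q (θ q) ⟩
        ι 8 * (Q * θ q)           ≡⟨ cong (ι 8 *_) (*-identityˡ (Q * θ q)) ⟨
        ι 8 * (1ℚ * (Q * θ q))    ≤⟨ *-monoˡ (0≤ι 8) (*-monoʳ (0≤* 0≤Q (0≤θ q)) (ι-mono {1} {suc q} (ℕ.s≤s ℕ.z≤n))) ⟩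
        ι 8 * T                   ∎
    B+B≤ε : B + B ≤ ε
    B+B≤ε = begin
      B + B                                                  ≤⟨ +-mono-≤ B≤ B≤ ⟩
      ι 20 * δ + ι 264 * T + (ι 20 * δ + ι 264 * T)          ≡⟨ lemma δ T ⟩
      ½ * (ι 80 * δ) + ½ * (ι 1056 * T)                      ≤⟨ +-mono-≤ (*-monoˡ {½} (≤ᵇ⇒≤ _) 80δ≤ε) (*-monoˡ {½} (≤ᵇ⇒≤ _) 1056T≤ε) ⟩
      ½ * ε + ½ * ε                                          ≡⟨ halves ε ⟩
      ε                                                      ∎
      where
      lemma : ∀ δ T → ι 20 * δ + ι 264 * T + (ι 20 * δ + ι 264 * T) ≡ ½ * (ι 80 * δ) + ½ * (ι 1056 * T)
      lemma = solve-∀ ℚ-ring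
      halves : ∀ ε → ½ * ε + ½ * ε ≡ ε
      halves = solve-∀ ℚ-ring
    final : 1ℚ - ε ≤ Prob n pₙ (AllKings 5 {n}) (dec n)
    final = begin
      1ℚ - ε            ≤⟨ +-monoˡ-≤ (- ε) (≤-trans
        (Prob-allKings q n 0≤p p≤½ δ≤½ (ℕ.<-≤-trans (ℕ.s≤s ℕ.z≤n) 1056K≤q) (m/n*n≤m n 32) (dec n))
        (+-monoʳ-≤ (Prob n pₙ (AllKings 5) (dec n)) B+B≤ε)) ⟩
      Prob n pₙ (AllKings 5) (dec n) + ε - ε    ≡⟨ cancel (Prob n pₙ (AllKings 5) (dec n)) ε ⟩
      Prob n pₙ (AllKings 5) (dec n)            ∎
      where
      cancel : ∀ x ε → x + ε - ε ≡ x
      cancel = solve-∀ ℚ-ring
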